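{- For every integer $t\geq 5$, there is a (finite, simple) graph $G_t$ with $E(G_t)\neq \varnothing$ such that $G_t$ is $C_{2t-2}$-free, but for every edge $e\in E(G_t)$ the graph $G_t-e$ (obtained from $G_t$ by removing the edge $e$) has an induced subgraph isomorphic to $C_{2t-2}$.
   Context: Graphs are finite, without loops or parallel edges. $C_k$ denotes the cycle on $k$ vertices. A graph $G$ is $H$-free if no induced subgraph of $G$ is isomorphic to $H$. -}

module Defs where

open import Data.Nat using (ℕ; suc; _+_)
open import Data.Nat.DivMod using (_%_)
open import Data.Fin using (Fin; toℕ; _≟_)
open import Data.Bool using (Bool; true; false; _∧_; _∨_; not)
open import Data.Product using (Σ; _×_; _,_)
open import Relation.Binary.PropositionalEquality using (_≡_; _≢_)
open import Relation.Nullary.Decidable using (⌊_⌋)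
open import Function.Definitions using (Injective)
import Data.Empty

record Graph : Set where
  field
    n    : ℕ
    adj  : Fin n → Fin n → Bool
    sym  : ∀ u v → adj u v ≡ adj v u
    irr  : ∀ v → adj v v ≡ false
open Graph public

Edge : Graph → Set
Edge G = Σ (Fin (n G)) λ u → Σ (Fin (n G)) λ v → adj G u v ≡ true

HasEdge : Graph → Set
HasEdge G = Edge G

-- Adjacency in the cycle C_k on vertex set Fin k (k ≥ 3 intended):
-- i ~ j iff j ≡ i+1 (mod k) or i ≡ j+1 (mod k).
cycAdj : (k : ℕ) → Fin (suc k) → Fin (suc k) → Bool
cycAdj k i j =
  ⌊ Data.Nat._≟_ (toℕ j) ((toℕ i + 1) % suc k) ⌋ ∨
  ⌊ Data.Nat._≟_ (toℕ i) ((toℕ j + 1) % suc k) ⌋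

HasInducedCycle : ℕ → Graph → Set
HasInducedCycle (suc k) G =
  Σ (Fin (suc k) → Fin (n G)) λ f →
    Injective _≡_ _≡_ f × (∀ i j → adj G (f i) (f j) ≡ cycAdj k i j)
HasInducedCycle 0 G = Data.Empty.⊥  -- C_0 is not a graph; never used (2t-2 ≥ 8)

CycleFree : ℕ → Graph → Set
CycleFree k G = HasInducedCycle k G → Data.Empty.⊥

sameEdge : ∀ {m} → Fin m → Fin m → Fin m → Fin m → Bool
sameEdge a b u v = (⌊ u ≟ a ⌋ ∧ ⌊ v ≟ b ⌋) ∨ (⌊ u ≟ b ⌋ ∧ ⌊ v ≟ a ⌋)

deleteEdge : (G : Graph) → Edge G → Graph
deleteEdge G (a , b , _) = record
  { n   = n G
  ; adj = λ u v → adj G u v ∧ not (sameEdge a b u v)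
  ; sym = λ u v → lemma u v
  ; irr = λ v → irrl v
  }
  where
  open import Data.Bool.Properties using (∨-comm; ∧-comm)
  open import Relation.Binary.PropositionalEquality using (cong₂; cong)
  lemma : ∀ u v → (adj G u v ∧ not (sameEdge a b u v)) ≡ (adj G v u ∧ not (sameEdge a b v u))
  lemma u v = cong₂ _∧_ (Graph.sym G u v) (cong not (Relation.Binary.PropositionalEquality.trans (∨-comm (⌊ u ≟ a ⌋ ∧ ⌊ v ≟ b ⌋) (⌊ u ≟ b ⌋ ∧ ⌊ v ≟ a ⌋)) (cong₂ _∨_ (∧-comm ⌊ u ≟ b ⌋ ⌊ v ≟ a ⌋) (∧-comm ⌊ u ≟ a ⌋ ⌊ v ≟ b ⌋))))
  irrl : ∀ v → (adj G v v ∧ not (sameEdge a b v v)) ≡ false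
  irrl v rewrite Graph.irr G v = Relation.Binary.PropositionalEquality.refl

{-# OPTIONS --safe #-}
module Submission where

-- The graph is the circulant graph on ℤ/N in which u and v are adjacent when they differ by
-- ±2, ±3 or ±4, where N = ⌊9k/2⌋ + 1 and 2k = 2t − 2.
--
-- Suppose X induces a cycle of length 2k.  Around each x ∈ X exactly two of x±2, x±3, x±4 lie
-- in X, and {x, x+1, x+3, x+4} ⊆ X is impossible, since these four vertices span a 4-cycle.
-- Read X as a cyclic 0/1 word.  Under these local rules the densest words are the powers of
-- 110011000, of density 4/9, so the deficit 4N − 9|X| is a sum of nonnegative local
-- terms (after adding a potential difference), and a word that both leaves and re-enters the
-- windows of (110011000)^∞ has deficit at least 5; a word avoiding those windows has density
-- at most 2/5.  But here the deficit 4N − 18k is 2 or 4.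
--
-- Conversely, after deleting an edge {a, a+d} there is a closed walk once around ℤ/N with 2k
-- steps, almost all of them in blocks 4, 4, −3, 4, which meets a and a+d at distance two or
-- three and has no other chord.

open import Defs
open import Data.Nat
open import Data.Nat.DivMod
open import Data.Nat.ListAction using () renaming (sum to sumˡ)
open import Data.Nat.ListAction.Properties using (sum-++)
open import Data.Nat.Properties
open import Data.Nat.Solver using (module +-*-Solver)
open import Data.Bool using (Bool; true; false; T; _∧_; _∨_; not; if_then_else_)
open import Data.Bool.Properties using (T-≡; T-∧; T?; ∨-comm; ∨-identityʳ; ∧-zeroʳ; ∧-identityʳ)
open import Data.Empty using (⊥; ⊥-elim)
import Data.Fin
open import Data.Fin using (Fin; toℕ; fromℕ<; zero; suc)
open import Data.Fin.Properties using (toℕ<n; toℕ-injective; toℕ-fromℕ<)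
open import Data.List using (List; []; _∷_; _++_; length)
open import Data.List.Properties using (length-++)
open import Data.Product using (Σ; ∃; _×_; _,_; proj₁; proj₂)
open import Data.Sum using (_⊎_; inj₁; inj₂; [_,_]′; map₂)
open import Data.Unit using (tt)
open import Data.Vec using (Vec; []; _∷_; _∷ʳ_; head; tail)
open import Function using (_∘_)
open import Function.Bundles using (module Equivalence)
open import Function.Definitions using (Injective)
open import Relation.Binary using (tri<; tri≈; tri>)
open import Relation.Binary.PropositionalEquality renaming (sym to ≡-sym)
open import Relation.Nullary using (¬_; yes; no)
open import Relation.Nullary.Decidable using (⌊_⌋; isYes≗does)
open import Algebra.Properties.CommutativeMonoid.Sum +-0-commutativeMonoid using (sum; sum-cong-≗; ∑-distrib-+)

-- Words with local rules.

toℕᵇ : Bool → ℕ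
toℕᵇ b = if b then 1 else 0

-- Decides a property of all Boolean words of length n by evaluation, so that the finite checks
-- below are proved by `tt`.
every : ∀ n → (Vec Bool n → Bool) → Bool
every zero    p = p []
every (suc n) p = every n (λ v → p (true ∷ v)) ∧ every n (λ v → p (false ∷ v))

every-sound : ∀ n p → T (every n p) → ∀ v → T (p v)
every-sound zero    p h []          = h
every-sound (suc n) p h (true ∷ v)  = every-sound n _ (proj₁ (Equivalence.to T-∧ h)) v
every-sound (suc n) p h (false ∷ v) = every-sound n _ (proj₂ (Equivalence.to (T-∧ {every n (λ v → p (true ∷ v))}) h)) v

Window : Set
Window = Vec Bool 8

slide : Window → Bool → Window
slide w b = tail (w ∷ʳ b)

admissible : Vec Bool 9 → Bool
admissible (b₀ ∷ b₁ ∷ b₂ ∷ b₃ ∷ b₄ ∷ _ ∷ b₆ ∷ b₇ ∷ b₈ ∷ []) =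
  not (b₀ ∧ b₁ ∧ b₃ ∧ b₄) ∧
  (not b₄ ∨ (toℕᵇ b₀ + (toℕᵇ b₁ + (toℕᵇ b₂ + (toℕᵇ b₆ + (toℕᵇ b₇ + toℕᵇ b₈)))) ≡ᵇ 2))

-- The windows of the periodic word (110011000)^∞.
tight : Window → Bool
tight (true  ∷ true  ∷ false ∷ false ∷ true  ∷ true  ∷ false ∷ false ∷ []) = true
tight (true  ∷ false ∷ false ∷ true  ∷ true  ∷ false ∷ false ∷ false ∷ []) = true
tight (false ∷ false ∷ true  ∷ true  ∷ false ∷ false ∷ false ∷ true  ∷ []) = true
tight (false ∷ true  ∷ true  ∷ false ∷ false ∷ false ∷ true  ∷ true  ∷ []) = true
tight (true  ∷ true  ∷ false ∷ false ∷ false ∷ true  ∷ true  ∷ false ∷ []) = true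
tight (true  ∷ false ∷ false ∷ false ∷ true  ∷ true  ∷ false ∷ false ∷ []) = true
tight (false ∷ false ∷ false ∷ true  ∷ true  ∷ false ∷ false ∷ true  ∷ []) = true
tight (false ∷ false ∷ true  ∷ true  ∷ false ∷ false ∷ true  ∷ true  ∷ []) = true
tight (false ∷ true  ∷ true  ∷ false ∷ false ∷ true  ∷ true  ∷ false ∷ []) = true
tight _ = false

entering : Window → Window → Bool
entering s t = not (tight s) ∧ tight t

-- Potentials are stored as tables so that the type checker evaluates each value once.
Table : ℕ → Set
Table zero    = ℕ
Table (suc n) = Table n × Table n

tabulate : ∀ n → (Vec Bool n → ℕ) → Table n
tabulate zero    f = f []
tabulate (suc n) f = tabulate n (λ v → f (true ∷ v)) , tabulate n (λ v → f (false ∷ v))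

lookup : ∀ {n} → Table n → Vec Bool n → ℕ
lookup t       []          = t
lookup (t , _) (true ∷ v)  = lookup t v
lookup (_ , t) (false ∷ v) = lookup t v

-- Bellman–Ford: the largest excess of the gain over c per step on a walk of at most m steps.
-- It is a potential once m reaches the fixed point, which happens for the m used below.
surplus : (Window → Bool → Bool) → (Window → Window → ℕ) → ℕ → ℕ → Table 8
surplus allowed gain c zero    = tabulate 8 (λ _ → 0)
surplus allowed gain c (suc m) = relax (surplus allowed gain c m)
  where
  extend : Table 8 → Window → Bool → ℕ
  extend t s b = if allowed s b then (gain s (slide s b) + lookup t (slide s b)) ∸ c else 0
  relax : Table 8 → Table 8
  relax t = tabulate 8 (λ s → extend t s true ⊔ extend t s false)

implies : Bool → Bool → Bool
implies a b = if a then b else true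

implies-sound : ∀ a {b} → T (implies a b) → T a → T b
implies-sound true h _ = h

-- A word of nine letters codes a transition here: the incoming letter first, then the window that
-- it extends.
claimed : (Window → Bool → Bool) → (Window → Bool → Table 8 → Bool) → Table 8 → Vec Bool 9 → Bool
claimed allowed claim t (b ∷ s) = implies (allowed s b) (claim s b t)

claimed-sound : ∀ allowed claim t → T (every 9 (claimed allowed claim t)) →
                ∀ s b → T (allowed s b) → T (claim s b t)
claimed-sound allowed claim t h s b =
  implies-sound (allowed s b) (every-sound 9 (claimed allowed claim t) h (b ∷ s))

-- Measured against 4 per step. A letter 1 earns 9, which compares 9|X| with 4N on a closed word of
-- length N; each entry into the tight windows earns 5 more.
gain₁ : Window → Window → ℕ
gain₁ s t = 9 * toℕᵇ (head s) + (if entering s t then 5 else 0)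

-- Measured against 2 per step, which corresponds to density 2/5.
gain₂ : Window → Window → ℕ
gain₂ s t = 5 * toℕᵇ (head s)

-- Transitions of the de Bruijn graph on windows: all admissible ones (`step₁`), those outside the
-- tight windows (`step₂`) and those inside them (`step₀`).
step₁ step₂ step₀ : Window → Bool → Bool
step₁ s b = admissible (s ∷ʳ b)
step₀ s b = admissible (s ∷ʳ b) ∧ (tight s ∧ tight (slide s b))
step₂ s b = admissible (s ∷ʳ b) ∧ (not (tight s) ∧ not (tight (slide s b)))

claim₁ claim₀ claim₂ : Window → Bool → Table 8 → Bool
claim₁ s b t = gain₁ s (slide s b) + lookup t (slide s b) ≤ᵇ 4 + lookup t s
claim₀ s b t = 4 + lookup t s ≤ᵇ gain₁ s (slide s b) + lookup t (slide s b)
claim₂ s b t = gain₂ s (slide s b) + lookup t (slide s b) ≤ᵇ 2 + lookup t s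

-- Opaque, so that nothing later unfolds the tables; the rest of the proof uses the three
-- inequalities.
abstract
  φ₁ φ₂ : Window → ℕ
  φ₁ = lookup (surplus step₁ gain₁ 4 13)
  φ₂ = lookup (surplus step₂ gain₂ 2 16)

  -- Verified on all 512 pairs of window and letter. Summed along a closed admissible walk the
  -- potentials cancel, so the gain, bonuses included, averages at most 4 per step.
  φ₁-bound : ∀ s b → T (step₁ s b) → gain₁ s (slide s b) + φ₁ (slide s b) ≤ 4 + φ₁ s
  φ₁-bound s b h = ≤ᵇ⇒≤ _ _ (claimed-sound step₁ claim₁ (surplus step₁ gain₁ 4 13) tt s b h)

  -- Together with `φ₁-bound` this is an equality along tight transitions: the word (110011000)^∞
  -- gains exactly 4 per step on average.
  φ₁-tight : ∀ s b → T (step₀ s b) → 4 + φ₁ s ≤ gain₁ s (slide s b) + φ₁ (slide s b)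
  φ₁-tight s b h = ≤ᵇ⇒≤ _ _ (claimed-sound step₀ claim₀ (surplus step₁ gain₁ 4 13) tt s b h)

  -- Once the tight windows are removed, the bound on the density drops from 4/9 to 2/5.
  φ₂-bound : ∀ s b → T (step₂ s b) → gain₂ s (slide s b) + φ₂ (slide s b) ≤ 2 + φ₂ s
  φ₂-bound s b h = ≤ᵇ⇒≤ _ _ (claimed-sound step₂ claim₂ (surplus step₂ gain₂ 2 16) tt s b h)

-- The circulant graph.

short : ℕ → Bool
short 2 = true
short 3 = true
short 4 = true
short _ = false

-- Here d is the distance of two representatives, and `N ∸ d` is the distance the other way around
-- the circle.
near : ℕ → ℕ → Bool
near N d = short d ∨ short (N ∸ d)

-- The orders start at 19, the case t = 5, so that 19 ≤ N is always at hand.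
circulant : ℕ → Graph
circulant r = record
  { n   = 19 + r
  ; adj = λ u v → near (19 + r) ∣ toℕ u - toℕ v ∣
  ; sym = λ u v → cong (near (19 + r)) (∣-∣-comm (toℕ u) (toℕ v))
  ; irr = λ v → cong (near (19 + r)) (∣n-n∣≡0 (toℕ v))
  }

near-reflect : ∀ N {d} → d ≤ N → near N (N ∸ d) ≡ near N d
near-reflect N {d} d≤N = trans (cong (λ e → short (N ∸ d) ∨ short e) (m∸[m∸n]≡n d≤N))
                           (∨-comm (short (N ∸ d)) (short d))

short-far : ∀ {d} → 5 ≤ d → short d ≡ false
short-far (s≤s (s≤s (s≤s (s≤s (s≤s _))))) = refl

-- Distances between residues modulo N.

module _ (N : ℕ) .{{_ : NonZero N}} where

  -- The two cases are whether adding d to the remainder of a stays below N or passes it.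
  ∣%-%∣-ordered : ∀ a d → d < N →
    ∣ a % N - (a + d) % N ∣ ≡ d ⊎ ∣ a % N - (a + d) % N ∣ ≡ N ∸ d
  ∣%-%∣-ordered a d d<N with a % N + d <? N
  ... | yes r+d<N = inj₁ (begin
      ∣ a % N - (a + d) % N ∣       ≡⟨ cong (∣ a % N -_∣) rem ⟩
      ∣ a % N - a % N + d ∣         ≡⟨ ∣m-m+n∣≡n (a % N) d ⟩
      d                             ∎)
    where
    open ≡-Reasoning
    rem : (a + d) % N ≡ a % N + d
    rem = begin
      (a + d) % N             ≡⟨ %-distribˡ-+ a d N ⟩
      (a % N + d % N) % N     ≡⟨ cong (λ x → (a % N + x) % N) (m<n⇒m%n≡m d<N) ⟩
      (a % N + d) % N         ≡⟨ m<n⇒m%n≡m r+d<N ⟩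
      a % N + d               ∎
  ... | no r+d≮N = inj₂ (begin
      ∣ a % N - (a + d) % N ∣               ≡⟨ ∣-∣-comm (a % N) _ ⟩
      ∣ (a + d) % N - a % N ∣               ≡⟨ cong₂ ∣_-_∣ rem back ⟩
      ∣ e - e + (N ∸ d) ∣                   ≡⟨ ∣m-m+n∣≡n e (N ∸ d) ⟩
      N ∸ d                                 ∎)
    where
    open ≡-Reasoning
    e = a % N + d ∸ N
    e+N : e + N ≡ a % N + d
    e+N = m∸n+n≡m (≮⇒≥ r+d≮N)
    e<N : e < N
    e<N = +-cancelʳ-< N e N (subst (_< N + N) (≡-sym e+N) (+-mono-< (m%n<n a N) d<N))
    back : a % N ≡ e + (N ∸ d)
    back = +-cancelʳ-≡ d _ _ (begin
      a % N + d            ≡⟨ ≡-sym e+N ⟩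
      e + N                ≡⟨ cong (e +_) (≡-sym (m∸n+n≡m (<⇒≤ d<N))) ⟩
      e + (N ∸ d + d)      ≡⟨ ≡-sym (+-assoc e (N ∸ d) d) ⟩
      e + (N ∸ d) + d      ∎)
    rem : (a + d) % N ≡ e
    rem = begin
      (a + d) % N             ≡⟨ %-distribˡ-+ a d N ⟩
      (a % N + d % N) % N     ≡⟨ cong (λ x → (a % N + x) % N) (m<n⇒m%n≡m d<N) ⟩
      (a % N + d) % N         ≡⟨ cong (_% N) (≡-sym e+N) ⟩
      (e + N) % N             ≡⟨ [m+n]%n≡m%n e N ⟩
      e % N                   ≡⟨ m<n⇒m%n≡m e<N ⟩
      e                       ∎

  ∣%-%∣ : ∀ a b → ∣ a - b ∣ < N →
    ∣ a % N - b % N ∣ ≡ ∣ a - b ∣ ⊎ ∣ a % N - b % N ∣ ≡ N ∸ ∣ a - b ∣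
  ∣%-%∣ a b lt with ≤-total a b
  ... | inj₁ a≤b = subst (λ c → ∣ a % N - c % N ∣ ≡ ∣ a - b ∣ ⊎ ∣ a % N - c % N ∣ ≡ N ∸ ∣ a - b ∣)
        (trans (cong (a +_) (m≤n⇒∣m-n∣≡n∸m a≤b)) (m+[n∸m]≡n a≤b))
        (∣%-%∣-ordered a ∣ a - b ∣ lt)
  ... | inj₂ b≤a rewrite ∣-∣-comm a b | ∣-∣-comm (a % N) (b % N) =
        subst (λ c → ∣ b % N - c % N ∣ ≡ ∣ b - a ∣ ⊎ ∣ b % N - c % N ∣ ≡ N ∸ ∣ b - a ∣)
        (trans (cong (b +_) (m≤n⇒∣m-n∣≡n∸m b≤a)) (m+[n∸m]≡n b≤a))
        (∣%-%∣-ordered b ∣ b - a ∣ lt)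

  -- The residues are at distance D or N - D, and `near` treats both alike. Hence adjacency can be
  -- read off any integer representatives less than N apart.
  near-% : ∀ a b → ∣ a - b ∣ < N → near N ∣ a % N - b % N ∣ ≡ near N ∣ a - b ∣
  near-% a b lt with ∣%-%∣ a b lt
  ... | inj₁ eq = cong (near N) eq
  ... | inj₂ eq = trans (cong (near N) eq) (near-reflect N (<⇒≤ lt))

  %-injective-near : ∀ a b → ∣ a - b ∣ < N → a % N ≡ b % N → a ≡ b
  %-injective-near a b lt eq with ∣%-%∣ a b lt
  ... | inj₁ h = ∣m-n∣≡0⇒m≡n (trans (≡-sym h) (m≡n⇒∣m-n∣≡0 eq))
  ... | inj₂ h = ⊥-elim (<⇒≢ (m<n⇒0<n∸m lt) (trans (≡-sym (m≡n⇒∣m-n∣≡0 eq)) h))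

-- The cyclic successor on the indices of a cycle.

next : ℕ → ℕ → ℕ
next k a = (a + 1) % suc k

next-inner : ∀ {k a} → a < k → next k a ≡ suc a
next-inner {k} {a} a<k = trans (m<n⇒m%n≡m (subst (_< suc k) (+-comm 1 a) (s≤s a<k))) (+-comm a 1)

next-last : ∀ k → next k k ≡ 0
next-last k = trans (cong (_% suc k) (+-comm k 1)) (n%n≡0 (suc k))

next-cases : ∀ {k a} → a ≤ k → (a < k × next k a ≡ suc a) ⊎ (a ≡ k × next k a ≡ 0)
next-cases {k} {a} a≤k with m≤n⇒m<n∨m≡n a≤k
... | inj₁ a<k  = inj₁ (a<k , next-inner a<k)
... | inj₂ refl = inj₂ (refl , next-last k)

next-≤ : ∀ k a → next k a ≤ k
next-≤ k a = s≤s⁻¹ (m%n<n (a + 1) (suc k))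

next-injective : ∀ {k a b} → a ≤ k → b ≤ k → next k a ≡ next k b → a ≡ b
next-injective {k} {a} {b} a≤k b≤k eq with next-cases a≤k | next-cases b≤k
... | inj₁ (_ , p) | inj₁ (_ , q) = suc-injective (trans (≡-sym p) (trans eq q))
... | inj₁ (_ , p) | inj₂ (_ , q) with () ← trans (≡-sym p) (trans eq q)
... | inj₂ (_ , p) | inj₁ (_ , q) with () ← trans (≡-sym p) (trans eq q)
... | inj₂ (p , _) | inj₂ (q , _) = trans p (≡-sym q)

-- Four successors add 4 modulo k + 1, and 4 < k + 1.
next⁴≢ : ∀ {k a} → 4 ≤ k → a ≤ k → next k (next k (next k (next k a))) ≢ a
next⁴≢ {k} {a} 4≤k a≤k eq = impossible
  where
  open ≡-Reasoning
  next-% : ∀ x → next k (x % suc k) ≡ (x + 1) % suc k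
  next-% x = begin
    (x % suc k + 1) % suc k               ≡⟨ %-distribˡ-+ (x % suc k) 1 (suc k) ⟩
    (x % suc k % suc k + 1 % suc k) % suc k ≡⟨ cong (λ y → (y + 1 % suc k) % suc k) (m%n%n≡m%n x (suc k)) ⟩
    (x % suc k + 1 % suc k) % suc k       ≡⟨ ≡-sym (%-distribˡ-+ x 1 (suc k)) ⟩
    (x + 1) % suc k                       ∎
  four : next k (next k (next k (next k a))) ≡ (4 + a) % suc k
  four = begin
    next k (next k (next k (next k a)))  ≡⟨ cong (λ y → next k (next k y)) (next-% (a + 1)) ⟩
    next k (next k ((a + 1 + 1) % suc k)) ≡⟨ cong (next k) (next-% (a + 1 + 1)) ⟩
    next k ((a + 1 + 1 + 1) % suc k)      ≡⟨ next-% (a + 1 + 1 + 1) ⟩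
    (a + 1 + 1 + 1 + 1) % suc k           ≡⟨ cong (_% suc k) (trans (+-assoc (a + 1 + 1) 1 1) (trans (+-assoc (a + 1) 1 2) (trans (+-assoc a 1 3) (+-comm a 4)))) ⟩
    (4 + a) % suc k                       ∎
  impossible : ⊥
  impossible = <⇒≢ (m<m+n a {4} (s≤s z≤n))
    (%-injective-near (suc k) a (a + 4)
      (subst (_< suc k) (≡-sym (∣m-m+n∣≡n a 4)) (s≤s 4≤k))
      (trans (m<n⇒m%n≡m (s≤s a≤k)) (trans (≡-sym eq) (trans four (cong (_% suc k) (+-comm 4 a))))))

-- The vertex set of an induced cycle.

≡ᵇ-true : ∀ {a b} → a ≡ b → (a ≡ᵇ b) ≡ true
≡ᵇ-true {a} {b} eq = Equivalence.to T-≡ (≡⇒≡ᵇ a b eq)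

≡ᵇ-false : ∀ {a b} → a ≢ b → (a ≡ᵇ b) ≡ false
≡ᵇ-false {a} {b} a≢b with a ≡ᵇ b in eq
... | false = refl
... | true  = ⊥-elim (a≢b (≡ᵇ⇒≡ a b (Equivalence.from T-≡ eq)))

≡ᵇ-cong : ∀ {a b c d} → (a ≡ b → c ≡ d) → (c ≡ d → a ≡ b) → (a ≡ᵇ b) ≡ (c ≡ᵇ d)
≡ᵇ-cong {a} {b} to from with a ≟ b
... | yes eq = trans (≡ᵇ-true eq) (≡-sym (≡ᵇ-true (to eq)))
... | no neq = trans (≡ᵇ-false neq) (≡-sym (≡ᵇ-false (neq ∘ from)))

Linked : ℕ → ℕ → ℕ → Set
Linked k a b = b ≡ next k a ⊎ a ≡ next k b

-- A closed walk of four steps on the cycle either turns back somewhere, which gives a = c or b = d,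
-- or keeps one direction and contradicts `next⁴≢`.
no-4-cycle : ∀ {k a b c d} → 4 ≤ k → a ≤ k → b ≤ k → c ≤ k → d ≤ k →
  Linked k a b → Linked k b c → Linked k c d → Linked k d a → a ≢ c → b ≢ d → ⊥
no-4-cycle 4≤k ak bk ck dk (inj₁ refl) (inj₂ p) _ _ a≢c _ = a≢c (next-injective ak ck p)
no-4-cycle 4≤k ak bk ck dk (inj₁ refl) (inj₁ refl) (inj₂ p) _ _ b≢d = b≢d (next-injective bk dk p)
no-4-cycle 4≤k ak bk ck dk (inj₁ refl) (inj₁ refl) (inj₁ refl) (inj₁ p) _ _ = next⁴≢ 4≤k ak (≡-sym p)
no-4-cycle 4≤k ak bk ck dk (inj₁ refl) (inj₁ refl) (inj₁ refl) (inj₂ p) _ b≢d = b≢d (≡-sym p)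
no-4-cycle 4≤k ak bk ck dk (inj₂ p) (inj₁ q) _ _ a≢c _ = a≢c (trans p (≡-sym q))
no-4-cycle 4≤k ak bk ck dk (inj₂ p) (inj₂ q) (inj₁ r) _ _ b≢d = b≢d (trans q (≡-sym r))
no-4-cycle 4≤k ak bk ck dk (inj₂ p) (inj₂ q) (inj₂ r) (inj₁ s) a≢c _ = a≢c (trans s (≡-sym r))
no-4-cycle {k} 4≤k ak bk ck dk (inj₂ refl) (inj₂ refl) (inj₂ refl) (inj₂ s) _ _ = next⁴≢ 4≤k dk (≡-sym s)

prev : ℕ → ℕ → ℕ
prev k zero    = k
prev k (suc a) = a

prev-≤ : ∀ {k a} → a ≤ k → prev k a ≤ k
prev-≤ {k} {zero}  _   = ≤-refl
prev-≤ {k} {suc a} a≤k = <⇒≤ a≤k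

next-prev : ∀ {k a} → a ≤ k → next k (prev k a) ≡ a
next-prev {k} {zero}  _   = next-last k
next-prev {k} {suc a} a<k = next-inner a<k

⌊≟⌋ : ∀ a b → ⌊ a ≟ b ⌋ ≡ (a ≡ᵇ b)
⌊≟⌋ a b = isYes≗does (a ≟ b)

-- The disjunction becomes a sum because successor and predecessor differ: otherwise two successors,
-- hence also four, would lead back to a.
linked-sum : ∀ {k a b} → 4 ≤ k → a ≤ k → b ≤ k →
  toℕᵇ (⌊ b ≟ next k a ⌋ ∨ ⌊ a ≟ next k b ⌋) ≡ toℕᵇ (b ≡ᵇ next k a) + toℕᵇ (b ≡ᵇ prev k a)
linked-sum {k} {a} {b} 4≤k a≤k b≤k
  rewrite ⌊≟⌋ b (next k a) | ⌊≟⌋ a (next k b)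
        | ≡ᵇ-cong {a} {next k b} {b} {prev k a}
            (λ eq → next-injective b≤k (prev-≤ a≤k) (trans (≡-sym eq) (≡-sym (next-prev a≤k))))
            (λ eq → trans (≡-sym (next-prev a≤k)) (cong (next k) (≡-sym eq)))
  with b ≡ᵇ next k a in p | b ≡ᵇ prev k a in q
... | false | _     = refl
... | true  | false = refl
... | true  | true  = ⊥-elim (next⁴≢ 4≤k a≤k (trans (cong (λ y → next k (next k y)) double) double))
  where
  double : next k (next k a) ≡ a
  double = trans (cong (next k) (trans (≡-sym (≡ᵇ⇒≡ b _ (Equivalence.from T-≡ p)))
                                       (≡ᵇ⇒≡ b _ (Equivalence.from T-≡ q)))) (next-prev a≤k)

sum-0 : ∀ {m} (t : Fin m → ℕ) → (∀ j → t j ≡ 0) → sum t ≡ 0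
sum-0 {zero}  t h = refl
sum-0 {suc m} t h = cong₂ _+_ (h zero) (sum-0 (t ∘ suc) (h ∘ suc))

sum-1 : ∀ {m} (t : Fin m → ℕ) → (∀ j → t j ≡ 1) → sum t ≡ m
sum-1 {zero}  t h = refl
sum-1 {suc m} t h = cong₂ _+_ (h zero) (sum-1 (t ∘ suc) (h ∘ suc))

sum-point : ∀ {m} c → c < m → sum {m} (λ j → toℕᵇ (toℕ j ≡ᵇ c)) ≡ 1
sum-point {suc m} zero    _         = cong suc (sum-0 {m} _ (λ _ → refl))
sum-point {suc m} (suc c) (s≤s c<m) = sum-point c c<m

count : ∀ {m} → (Fin m → ℕ) → ℕ → ℕ
count g v = sum (λ j → toℕᵇ (g j ≡ᵇ v))

count-≤1 : ∀ {m} (g : Fin m → ℕ) → Injective _≡_ _≡_ g → ∀ v → count g v ≤ 1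
count-≤1 {zero}  g inj v = z≤n
count-≤1 {suc m} g inj v with g zero ≡ᵇ v in eq
... | false = count-≤1 (g ∘ suc) (λ h → Data.Fin.Properties.suc-injective (inj h)) v
... | true  = s≤s (≤-reflexive (sum-0 {m} _ (λ j → cong toℕᵇ (≡ᵇ-false (λ h →
      Data.Fin.Properties.0≢1+n (inj (trans (≡ᵇ⇒≡ _ _ (Equivalence.from T-≡ eq)) (≡-sym h))))))))

count-witness : ∀ {m} (g : Fin m → ℕ) v → 0 < count g v → ∃ λ j → g j ≡ v
count-witness {suc m} g v h with g zero ≡ᵇ v in eq
... | true  = zero , ≡ᵇ⇒≡ _ _ (Equivalence.from T-≡ eq)
... | false with j , p ← count-witness (g ∘ suc) v h = suc j , p

toℕᵇ-< : ∀ a x → toℕᵇ (a <ᵇ suc x) ≡ toℕᵇ (a <ᵇ x) + toℕᵇ (a ≡ᵇ x)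
toℕᵇ-< zero    zero    = refl
toℕᵇ-< zero    (suc x) = refl
toℕᵇ-< (suc a) zero    = refl
toℕᵇ-< (suc a) (suc x) = toℕᵇ-< a x

∣-∣-cancelʳ : ∀ a b c → ∣ a + c - b + c ∣ ≡ ∣ a - b ∣
∣-∣-cancelʳ a b c rewrite +-comm a c | +-comm b c = ∣m+n-m+o∣≡∣n-o∣ c a b

∣-∣-< : ∀ {N} a b → a < N → b < N → ∣ a - b ∣ < N
∣-∣-< a b a<N b<N = ≤-<-trans (∣m-n∣≤m⊔n a b) (⊔-pres-<m a<N b<N)

telescope : ∀ c N (F : ℕ → ℕ) → (∀ {x} → x < N → F (suc x) ≤ c + F x) →
            ∀ d x → d + x ≤ N → F (d + x) ≤ c * d + F x
telescope c N F h zero    x _  rewrite *-zeroʳ c = ≤-refl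
telescope c N F h (suc d) x le = begin
  F (suc (d + x))       ≤⟨ h le ⟩
  c + F (d + x)         ≤⟨ +-monoʳ-≤ c (telescope c N F h d x (<⇒≤ le)) ⟩
  c + (c * d + F x)     ≡⟨ ≡-sym (+-assoc c _ _) ⟩
  c + c * d + F x       ≡⟨ cong (_+ F x) (≡-sym (*-suc c d)) ⟩
  c * suc d + F x       ∎
  where open ≤-Reasoning

nand₄ : ∀ a b c d → (T a → T b → T c → T d → ⊥) → T (not (a ∧ b ∧ c ∧ d))
nand₄ false _     _     _     _ = tt
nand₄ true  false _     _     _ = tt
nand₄ true  true  false _     _ = tt
nand₄ true  true  true  false _ = tt
nand₄ true  true  true  true  h = h tt tt tt tt

implies-≡2 : ∀ b {m} → (T b → m ≡ 2) → T (not b ∨ (m ≡ᵇ 2))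
implies-≡2 false     _ = tt
implies-≡2 true {m}  h = ≡⇒≡ᵇ m 2 (h tt)

-- The witness is w - x modulo N; it allows any vertex to be described relative to x.
offset : ∀ N .{{_ : NonZero N}} x w → w < N → ∃ λ s → s < N × (s + x) % N ≡ w
offset N x w w<N = (w + (N ∸ x % N)) % N , m%n<n (w + (N ∸ x % N)) N , (begin
  ((w + (N ∸ x % N)) % N + x) % N               ≡⟨ %-distribˡ-+ ((w + (N ∸ x % N)) % N) x N ⟩
  ((w + (N ∸ x % N)) % N % N + x % N) % N       ≡⟨ cong (λ y → (y + x % N) % N) (m%n%n≡m%n (w + (N ∸ x % N)) N) ⟩
  ((w + (N ∸ x % N)) % N + x % N) % N           ≡⟨ cong (λ y → ((w + (N ∸ x % N)) % N + y) % N) (≡-sym (m%n%n≡m%n x N)) ⟩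
  ((w + (N ∸ x % N)) % N + x % N % N) % N       ≡⟨ ≡-sym (%-distribˡ-+ (w + (N ∸ x % N)) (x % N) N) ⟩
  (w + (N ∸ x % N) + x % N) % N                 ≡⟨ cong (_% N) (trans (+-assoc w _ _) (cong (w +_) (m∸n+n≡m (m%n≤n x N)))) ⟩
  (w + N) % N                                   ≡⟨ [m+n]%n≡m%n w N ⟩
  w % N                                         ≡⟨ m<n⇒m%n≡m w<N ⟩
  w                                             ∎)
  where open ≡-Reasoning


near-far : ∀ {N d} → 5 + d ≤ N → near N d ≡ short d
near-far {N} {d} le rewrite short-far (m+n≤o⇒m≤o∸n 5 le) = ∨-identityʳ (short d)

-- The offsets 0, 1, 2, 6, 7, 8 are 4 ± 2, 4 ± 3, 4 ± 4, so this is one row of the adjacency matrix.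
-- For N ≥ 19 no other s < N becomes adjacent to 4 by wrapping around.
near-offsets : ∀ {N} → 19 ≤ N → ∀ s → s < N → toℕᵇ (near N ∣ 4 - s ∣) ≡
    toℕᵇ (s ≡ᵇ 0) + (toℕᵇ (s ≡ᵇ 1) + (toℕᵇ (s ≡ᵇ 2) + (toℕᵇ (s ≡ᵇ 6) + (toℕᵇ (s ≡ᵇ 7) + toℕᵇ (s ≡ᵇ 8)))))
near-offsets 19≤N 0 _ = refl
near-offsets 19≤N 1 _ = refl
near-offsets 19≤N 2 _ = refl
near-offsets 19≤N 3 _ = cong toℕᵇ (near-far (≤-trans (m≤m+n 6 13) 19≤N))
near-offsets 19≤N 4 _ = cong toℕᵇ (near-far (≤-trans (m≤m+n 5 14) 19≤N))
near-offsets 19≤N 5 _ = cong toℕᵇ (near-far (≤-trans (m≤m+n 6 13) 19≤N))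
near-offsets 19≤N 6 _ = refl
near-offsets 19≤N 7 _ = refl
near-offsets 19≤N 8 _ = refl
near-offsets 19≤N (suc (suc (suc (suc (suc (suc (suc (suc (suc s))))))))) s<N =
  cong toℕᵇ (near-far s<N)

sum₆ : ∀ {m} (a b c d e f : Fin m → ℕ) →
  sum a + (sum b + (sum c + (sum d + (sum e + sum f)))) ≡ sum (λ j → a j + (b j + (c j + (d j + (e j + f j)))))
sum₆ {m} a b c d e f = begin
  sum a + (sum b + (sum c + (sum d + (sum e + sum f))))
    ≡⟨ cong (λ y → sum a + (sum b + (sum c + (sum d + y)))) (≡-sym (∑-distrib-+ e f)) ⟩
  sum a + (sum b + (sum c + (sum d + sum ef)))
    ≡⟨ cong (λ y → sum a + (sum b + (sum c + y))) (≡-sym (∑-distrib-+ d ef)) ⟩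
  sum a + (sum b + (sum c + sum def))
    ≡⟨ cong (λ y → sum a + (sum b + y)) (≡-sym (∑-distrib-+ c def)) ⟩
  sum a + (sum b + sum cdef)
    ≡⟨ cong (λ y → sum a + y) (≡-sym (∑-distrib-+ b cdef)) ⟩
  sum a + sum bcdef
    ≡⟨ ≡-sym (∑-distrib-+ a bcdef) ⟩
  sum (λ j → a j + bcdef j) ∎
  where
  open ≡-Reasoning
  ef def cdef bcdef : Fin m → ℕ
  ef    j = e j + f j
  def   j = d j + ef j
  cdef  j = c j + def j
  bcdef j = b j + cdef j


-- The local rules obeyed by the vertex set of an induced cycle.

module InducedCycle (N : ℕ) .{{_ : NonZero N}} (19≤N : 19 ≤ N) (k : ℕ) (4≤k : 4 ≤ k)
  (f : Fin (suc k) → Fin N) (f-injective : Injective _≡_ _≡_ f)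
  (induced : ∀ i j → near N ∣ toℕ (f i) - toℕ (f j) ∣ ≡ cycAdj k i j) where

  g : Fin (suc k) → ℕ
  g = toℕ ∘ f

  g-injective : Injective _≡_ _≡_ g
  g-injective = f-injective ∘ toℕ-injective

  toℕ≤k : (i : Fin (suc k)) → toℕ i ≤ k
  toℕ≤k i = s≤s⁻¹ (toℕ<n i)

  hits : ℕ → ℕ
  hits x = count g (x % N)

  -- Indicator of the vertex set X, read as an N-periodic word.
  χ : ℕ → Bool
  χ x = 0 <ᵇ hits x

  hits-χ : ∀ x → hits x ≡ toℕᵇ (χ x)
  hits-χ x with hits x | count-≤1 g g-injective (x % N)
  ... | 0 | _ = refl
  ... | 1 | _ = refl
  ... | suc (suc _) | s≤s ()

  χ-witness : ∀ x → T (χ x) → ∃ λ i → g i ≡ x % N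
  χ-witness x h = count-witness g (x % N) (<ᵇ⇒< 0 (hits x) h)

  -- Prefix counts of X, summed over the cycle rather than over positions, so that the value at N is
  -- the cycle length; `below-suc` identifies them with the partial sums of `χ`.
  below : ℕ → ℕ
  below x = sum (λ j → toℕᵇ (g j <ᵇ x))

  below-0 : below 0 ≡ 0
  below-0 = sum-0 (λ j → toℕᵇ (g j <ᵇ 0)) (λ j → refl)

  below-N : below N ≡ suc k
  below-N = sum-1 _ (λ j → cong toℕᵇ (Equivalence.to (T-≡ {g j <ᵇ N}) (<⇒<ᵇ (toℕ<n (f j)))))

  below-suc : ∀ {x} → x < N → below (suc x) ≡ below x + toℕᵇ (χ x)
  below-suc {x} x<N = begin
    below (suc x)          ≡⟨ sum-cong-≗ {suc k} (λ j → toℕᵇ-< (g j) x) ⟩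
    sum (λ j → toℕᵇ (g j <ᵇ x) + toℕᵇ (g j ≡ᵇ x)) ≡⟨ ∑-distrib-+ {suc k} (λ j → toℕᵇ (g j <ᵇ x)) (λ j → toℕᵇ (g j ≡ᵇ x)) ⟩
    below x + count g x    ≡⟨ cong (λ y → below x + count g y) (≡-sym (m<n⇒m%n≡m x<N)) ⟩
    below x + hits x       ≡⟨ cong (below x +_) (hits-χ x) ⟩
    below x + toℕᵇ (χ x)   ∎
    where open ≡-Reasoning

  sum-cycAdj : ∀ i → sum (λ j → toℕᵇ (cycAdj k i j)) ≡ 2
  sum-cycAdj i = begin
    sum (λ j → toℕᵇ (cycAdj k i j))
      ≡⟨ sum-cong-≗ {suc k} (λ j → linked-sum 4≤k (toℕ≤k i) (toℕ≤k j)) ⟩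
    sum {suc k} (λ j → toℕᵇ (toℕ j ≡ᵇ next k (toℕ i)) + toℕᵇ (toℕ j ≡ᵇ prev k (toℕ i)))
      ≡⟨ ∑-distrib-+ {suc k} (λ j → toℕᵇ (toℕ j ≡ᵇ next k (toℕ i))) (λ j → toℕᵇ (toℕ j ≡ᵇ prev k (toℕ i))) ⟩
    sum {suc k} (λ j → toℕᵇ (toℕ j ≡ᵇ next k (toℕ i))) + sum {suc k} (λ j → toℕᵇ (toℕ j ≡ᵇ prev k (toℕ i)))
      ≡⟨ cong₂ _+_ (sum-point {suc k} (next k (toℕ i)) (s≤s (next-≤ k (toℕ i)))) (sum-point {suc k} (prev k (toℕ i)) (s≤s (prev-≤ (toℕ≤k i)))) ⟩
    2 ∎
    where open ≡-Reasoning

  at : ℕ → ℕ → ℕ → ℕ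
  at x w d = toℕᵇ (w ≡ᵇ (d + x) % N)

  near-sum : ∀ x w → w < N → toℕᵇ (near N ∣ (4 + x) % N - w ∣) ≡
    at x w 0 + (at x w 1 + (at x w 2 + (at x w 6 + (at x w 7 + at x w 8))))
  near-sum x w w<N with s , s<N , refl ← offset N x w w<N = begin
    toℕᵇ (near N ∣ (4 + x) % N - (s + x) % N ∣) ≡⟨ cong toℕᵇ (near-% N (4 + x) (s + x) (subst (_< N) (≡-sym (∣-∣-cancelʳ 4 s x)) small)) ⟩
    toℕᵇ (near N ∣ 4 + x - s + x ∣)             ≡⟨ cong (toℕᵇ ∘ near N) (∣-∣-cancelʳ 4 s x) ⟩
    toℕᵇ (near N ∣ 4 - s ∣)                     ≡⟨ near-offsets 19≤N s s<N ⟩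
    _ ≡⟨ cong₂ _+_ (same 0) (cong₂ _+_ (same 1) (cong₂ _+_ (same 2) (cong₂ _+_ (same 6) (cong₂ _+_ (same 7) (same 8))))) ⟩
    _ ∎
    where
    open ≡-Reasoning
    small : ∣ 4 - s ∣ < N
    small = ∣-∣-< 4 s (≤-trans (m≤m+n 5 14) 19≤N) s<N
    same : ∀ d → {T (d <ᵇ 19)} → toℕᵇ (s ≡ᵇ d) ≡ at x ((s + x) % N) d
    same d {d<} = cong toℕᵇ (≡ᵇ-cong (λ eq → cong (λ y → (y + x) % N) eq)
      (λ eq → +-cancelʳ-≡ x s d (%-injective-near N (s + x) (d + x)
        (subst (_< N) (≡-sym (∣-∣-cancelʳ s d x))
          (∣-∣-< s d s<N (≤-trans (<ᵇ⇒< d 19 d<) 19≤N))) eq)))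

  -- Both sides count the neighbours of 4 + x in X: once by the offsets ±2, ±3, ±4, once as the two
  -- neighbours along the cycle.
  degree : ∀ x → T (χ (4 + x)) →
    toℕᵇ (χ x) + (toℕᵇ (χ (1 + x)) + (toℕᵇ (χ (2 + x)) + (toℕᵇ (χ (6 + x)) + (toℕᵇ (χ (7 + x)) + toℕᵇ (χ (8 + x)))))) ≡ 2
  degree x h with i , gi ← χ-witness (4 + x) h = begin
    _ ≡⟨ ≡-sym (cong₂ _+_ (hits-χ x) (cong₂ _+_ (hits-χ (1 + x)) (cong₂ _+_ (hits-χ (2 + x)) (cong₂ _+_ (hits-χ (6 + x)) (cong₂ _+_ (hits-χ (7 + x)) (hits-χ (8 + x))))))) ⟩
    sum (a 0) + (sum (a 1) + (sum (a 2) + (sum (a 6) + (sum (a 7) + sum (a 8)))))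
      ≡⟨ sum₆ (a 0) (a 1) (a 2) (a 6) (a 7) (a 8) ⟩
    sum (λ j → a 0 j + (a 1 j + (a 2 j + (a 6 j + (a 7 j + a 8 j)))))
      ≡⟨ sum-cong-≗ {suc k} (λ j → ≡-sym (near-sum x (g j) (toℕ<n (f j)))) ⟩
    sum (λ j → toℕᵇ (near N ∣ (4 + x) % N - g j ∣))
      ≡⟨ sum-cong-≗ {suc k} (λ j → cong (λ y → toℕᵇ (near N ∣ y - g j ∣)) (≡-sym gi)) ⟩
    sum (λ j → toℕᵇ (near N ∣ g i - g j ∣))
      ≡⟨ sum-cong-≗ {suc k} (λ j → cong toℕᵇ (induced i j)) ⟩
    sum (λ j → toℕᵇ (cycAdj k i j))
      ≡⟨ sum-cycAdj i ⟩
    2 ∎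
    where
    open ≡-Reasoning
    a : ℕ → Fin (suc k) → ℕ
    a d j = at x (g j) d

  linked : ∀ x i j d e → g i ≡ (d + x) % N → g j ≡ (e + x) % N → T (∣ d - e ∣ <ᵇ 19) →
           T (short ∣ d - e ∣) → Linked k (toℕ i) (toℕ j)
  linked x i j d e gi gj lt sh with toℕ j ≟ next k (toℕ i) | toℕ i ≟ next k (toℕ j) | induced i j
  ... | yes p | _     | _ = inj₁ p
  ... | no _  | yes q | _ = inj₂ q
  ... | no _  | no _  | eq = ⊥-elim (subst T (trans (≡-sym step) eq) tt)
    where
    step : near N ∣ g i - g j ∣ ≡ true
    step rewrite gi | gj
      | near-% N (d + x) (e + x) (subst (_< N) (≡-sym (∣-∣-cancelʳ d e x)) (≤-trans (<ᵇ⇒< ∣ d - e ∣ 19 lt) 19≤N))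
      | ∣-∣-cancelʳ d e x | Equivalence.to T-≡ sh = refl

  no-square : ∀ x → T (χ x) → T (χ (1 + x)) → T (χ (3 + x)) → T (χ (4 + x)) → ⊥
  no-square x h₀ h₁ h₃ h₄
    with i₀ , p₀ ← χ-witness x h₀ | i₁ , p₁ ← χ-witness (1 + x) h₁
       | i₃ , p₃ ← χ-witness (3 + x) h₃ | i₄ , p₄ ← χ-witness (4 + x) h₄ =
    -- The closed walk x, x + 3, x + 1, x + 4 has steps 3, -2, 3, -4, all of them edges.
    no-4-cycle 4≤k (toℕ≤k i₀) (toℕ≤k i₃) (toℕ≤k i₁) (toℕ≤k i₄)
      (linked x i₀ i₃ 0 3 p₀ p₃ tt tt) (linked x i₃ i₁ 3 1 p₃ p₁ tt tt)
      (linked x i₁ i₄ 1 4 p₁ p₄ tt tt) (linked x i₄ i₀ 4 0 p₄ p₀ tt tt)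
      (distinct i₀ i₁ 0 p₀ p₁) (distinct i₃ i₄ 3 p₃ p₄)
    where
    distinct : ∀ i j d → g i ≡ (d + x) % N → g j ≡ (suc d + x) % N → toℕ i ≢ toℕ j
    distinct i j d gi gj eq = 1+n≢n (≡-sym (%-injective-near N (d + x) (suc (d + x))
      (subst (_< N) (≡-sym (trans (cong (∣ d + x -_∣) (+-comm 1 (d + x))) (∣m-m+n∣≡n (d + x) 1))) (≤-trans (m≤m+n 2 17) 19≤N))
      (trans (≡-sym gi) (trans (cong g (toℕ-injective eq)) gj))))

  χ-periodic : ∀ x → χ (x + N) ≡ χ x
  χ-periodic x = cong (λ y → 0 <ᵇ count g y) ([m+n]%n≡m%n x N)

-- Density of the vertex set.

window : (ℕ → Bool) → ℕ → Window
window χ x = χ x ∷ χ (1 + x) ∷ χ (2 + x) ∷ χ (3 + x) ∷ χ (4 + x) ∷ χ (5 + x) ∷ χ (6 + x) ∷ χ (7 + x) ∷ []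

window-periodic : ∀ χ {N} → (∀ x → χ (x + N) ≡ χ x) → window χ N ≡ window χ 0
window-periodic χ periodic
  rewrite periodic 0 | periodic 1 | periodic 2 | periodic 3
        | periodic 4 | periodic 5 | periodic 6 | periodic 7 = refl

T-not : ∀ {b} → ¬ T b → T (not b)
T-not {false} _ = tt
T-not {true}  h = h tt

module Density (χ : ℕ → Bool) (S : ℕ → ℕ) (N L : ℕ)
  (S-0 : S 0 ≡ 0) (S-N : S N ≡ L) (S-suc : ∀ {x} → x < N → S (suc x) ≡ S x + toℕᵇ (χ x))
  (ok : ∀ x → T (admissible (window χ x ∷ʳ χ (8 + x)))) (w-periodic : window χ N ≡ window χ 0) where

  w : ℕ → Window
  w = window χ

  -- Gain collected before position x, bonuses left out, plus the potential of the window at x.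
  weight : ℕ → (Window → ℕ) → ℕ → ℕ
  weight q φ x = q * S x + φ (w x)

  weight-N : ∀ q φ → weight q φ N ≡ q * L + φ (w 0)
  weight-N q φ rewrite S-N | w-periodic = refl

  weight-0 : ∀ q φ → weight q φ 0 ≡ φ (w 0)
  weight-0 q φ rewrite S-0 | *-zeroʳ q = refl

  weight-suc : ∀ q φ {x} → x < N → weight q φ (suc x) ≡ q * S x + (q * toℕᵇ (χ x) + φ (w (suc x)))
  weight-suc q φ {x} x<N rewrite S-suc x<N | *-distribˡ-+ q (S x) (toℕᵇ (χ x)) = +-assoc (q * S x) _ _

  bonus : ℕ → ℕ
  bonus x = if entering (w x) (w (suc x)) then 5 else 0

  weight-bound : ∀ {x} → x < N → bonus x + weight 9 φ₁ (suc x) ≤ 4 + weight 9 φ₁ x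
  weight-bound {x} x<N rewrite weight-suc 9 φ₁ x<N = begin
    bonus x + (9 * S x + (9 * toℕᵇ (χ x) + φ₁ (w (suc x))))
      ≡⟨ solve 4 (λ b s c f → b :+ (s :+ (c :+ f)) := s :+ ((c :+ b) :+ f)) refl (bonus x) (9 * S x) (9 * toℕᵇ (χ x)) (φ₁ (w (suc x))) ⟩
    9 * S x + (9 * toℕᵇ (χ x) + bonus x + φ₁ (w (suc x)))
      ≤⟨ +-monoʳ-≤ (9 * S x) (φ₁-bound (w x) (χ (8 + x)) (ok x)) ⟩
    9 * S x + (4 + φ₁ (w x))
      ≡⟨ solve 2 (λ s f → s :+ (con 4 :+ f) := con 4 :+ (s :+ f)) refl (9 * S x) (φ₁ (w x)) ⟩
    4 + weight 9 φ₁ x ∎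
    where
    open ≤-Reasoning
    open +-*-Solver

  weight-step : ∀ {x} → x < N → weight 9 φ₁ (suc x) ≤ 4 + weight 9 φ₁ x
  weight-step x<N = ≤-trans (m≤n+m _ (bonus _)) (weight-bound x<N)

  Tight : ℕ → Set
  Tight x = T (tight (w x))

  -- Telescope the bound of 4 per step once around; the step at x has 5 to spare. The potentials at
  -- both ends cancel, since the window at N is the window at 0.
  enter⇒long : ∀ {x} → x < N → ¬ Tight x → Tight (suc x) → 9 * L + 5 ≤ 4 * N
  enter⇒long {x} x<N ¬tx ty = +-cancelʳ-≤ (φ₁ (w 0)) (9 * L + 5) (4 * N) (begin
    9 * L + 5 + φ₁ (w 0)                  ≡⟨ solve 2 (λ l f → l :+ con 5 :+ f := con 5 :+ (l :+ f)) refl (9 * L) (φ₁ (w 0)) ⟩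
    5 + (9 * L + φ₁ (w 0))                ≡⟨ cong (5 +_) (≡-sym (weight-N 9 φ₁)) ⟩
    5 + F N                               ≡⟨ cong (λ y → 5 + F y) (≡-sym d+x≡N) ⟩
    5 + F (d + suc x)                     ≤⟨ +-monoʳ-≤ 5 (telescope 4 N F weight-step d (suc x) (≤-reflexive d+x≡N)) ⟩
    5 + (4 * d + F (suc x))               ≡⟨ solve 2 (λ d f → con 5 :+ (con 4 :* d :+ f) := con 4 :* d :+ (con 5 :+ f)) refl d (F (suc x)) ⟩
    4 * d + (5 + F (suc x))               ≤⟨ +-monoʳ-≤ (4 * d) jump ⟩
    4 * d + (4 + F x)                     ≤⟨ +-monoʳ-≤ (4 * d) (+-monoʳ-≤ 4 first) ⟩
    4 * d + (4 + (4 * x + φ₁ (w 0)))      ≡⟨ solve 3 (λ d x f → con 4 :* d :+ (con 4 :+ (con 4 :* x :+ f)) := con 4 :* (d :+ (con 1 :+ x)) :+ f) refl d x (φ₁ (w 0)) ⟩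
    4 * (d + suc x) + φ₁ (w 0)            ≡⟨ cong (λ y → 4 * y + φ₁ (w 0)) d+x≡N ⟩
    4 * N + φ₁ (w 0)                      ∎)
    where
    open ≤-Reasoning
    open +-*-Solver
    F : ℕ → ℕ
    F = weight 9 φ₁
    d : ℕ
    d = N ∸ suc x
    d+x≡N : d + suc x ≡ N
    d+x≡N = m∸n+n≡m x<N
    first : F x ≤ 4 * x + φ₁ (w 0)
    first = begin
      F x             ≡⟨ cong F (≡-sym (+-identityʳ x)) ⟩
      F (x + 0)       ≤⟨ telescope 4 N F weight-step x 0 (subst (_≤ N) (≡-sym (+-identityʳ x)) (<⇒≤ x<N)) ⟩
      4 * x + F 0     ≡⟨ cong (4 * x +_) (weight-0 9 φ₁) ⟩
      4 * x + φ₁ (w 0) ∎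
    jump : 5 + F (suc x) ≤ 4 + F x
    jump = subst (λ b → (if b then 5 else 0) + F (suc x) ≤ 4 + F x)
      (Equivalence.to T-≡ (Equivalence.from T-∧ (T-not ¬tx , ty))) (weight-bound x<N)

  -- Along tight transitions the bounds are equalities, so the weight rises by exactly 4 at every
  -- step.
  all-tight⇒ : (∀ x → x ≤ N → Tight x) → 4 * N ≡ 9 * L
  all-tight⇒ all = +-cancelʳ-≡ (φ₁ (w 0)) (4 * N) (9 * L) (trans (≡-sym (exact N ≤-refl)) (weight-N 9 φ₁))
    where
    exact : ∀ x → x ≤ N → weight 9 φ₁ x ≡ 4 * x + φ₁ (w 0)
    exact zero    _   = weight-0 9 φ₁
    exact (suc x) x<N = begin
      weight 9 φ₁ (suc x)                     ≡⟨ ≤-antisym (weight-step x<N) other ⟩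
      4 + weight 9 φ₁ x                       ≡⟨ cong (4 +_) (exact x (<⇒≤ x<N)) ⟩
      4 + (4 * x + φ₁ (w 0))                  ≡⟨ solve 2 (λ x f → con 4 :+ (con 4 :* x :+ f) := con 4 :* (con 1 :+ x) :+ f) refl x (φ₁ (w 0)) ⟩
      4 * suc x + φ₁ (w 0)                    ∎
      where
      open ≡-Reasoning
      open +-*-Solver
      no-bonus : bonus x ≡ 0
      no-bonus rewrite Equivalence.to T-≡ (all x (<⇒≤ x<N)) = refl
      other : 4 + weight 9 φ₁ x ≤ weight 9 φ₁ (suc x)
      other rewrite weight-suc 9 φ₁ x<N = ≤-trans
        (≤-reflexive (solve 2 (λ s f → con 4 :+ (s :+ f) := s :+ (con 4 :+ f)) refl (9 * S x) (φ₁ (w x))))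
        (+-monoʳ-≤ (9 * S x) (≤-trans
          (φ₁-tight (w x) (χ (8 + x)) (Equivalence.from T-∧ (ok x , Equivalence.from T-∧ (all x (<⇒≤ x<N) , all (suc x) x<N))))
          (≤-reflexive (cong (_+ φ₁ (w (suc x))) (trans (cong (9 * toℕᵇ (χ x) +_) no-bonus) (+-identityʳ _))))))

  none-tight⇒ : (∀ x → x ≤ N → ¬ Tight x) → 5 * L ≤ 2 * N
  none-tight⇒ none = +-cancelʳ-≤ (φ₂ (w 0)) (5 * L) (2 * N) (begin
    5 * L + φ₂ (w 0)           ≡⟨ ≡-sym (weight-N 5 φ₂) ⟩
    weight 5 φ₂ N              ≡⟨ cong (weight 5 φ₂) (≡-sym (+-identityʳ N)) ⟩
    weight 5 φ₂ (N + 0)        ≤⟨ telescope 2 N (weight 5 φ₂) step N 0 (≤-reflexive (+-identityʳ N)) ⟩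
    2 * N + weight 5 φ₂ 0      ≡⟨ cong (2 * N +_) (weight-0 5 φ₂) ⟩
    2 * N + φ₂ (w 0)           ∎)
    where
    open ≤-Reasoning
    open +-*-Solver
    step : ∀ {x} → x < N → weight 5 φ₂ (suc x) ≤ 2 + weight 5 φ₂ x
    step {x} x<N rewrite weight-suc 5 φ₂ x<N = ≤-trans
      (+-monoʳ-≤ (5 * S x) (φ₂-bound (w x) (χ (8 + x)) (Equivalence.from T-∧
        (ok x , Equivalence.from T-∧ (T-not (none x (<⇒≤ x<N)) , T-not (none (suc x) x<N))))))
      (≤-reflexive (solve 2 (λ s f → s :+ (con 2 :+ f) := con 2 :+ (s :+ f)) refl (5 * S x) (φ₂ (w x))))

  -- By `enter⇒long` the word never enters the tight windows. Since the windows at 0 and N coincide,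
  -- all windows are tight or none is: tightness is carried backwards from N, its failure forwards
  -- from 0.
  density : 4 * N < 9 * L + 5 → 4 * N ≡ 9 * L ⊎ 5 * L ≤ 2 * N
  density short-N with T? (tight (w 0))
  ... | yes t₀ = inj₁ (all-tight⇒ λ x x≤N → descend (N ∸ x) x (m∸n+n≡m x≤N))
    where
    back : ∀ {x} → x < N → Tight (suc x) → Tight x
    back {x} x<N t with T? (tight (w x))
    ... | yes tx = tx
    ... | no ¬tx = ⊥-elim (<⇒≱ short-N (enter⇒long x<N ¬tx t))
    descend : ∀ d x → d + x ≡ N → Tight x
    descend zero    x refl = subst (T ∘ tight) (≡-sym w-periodic) t₀
    descend (suc d) x eq   = back (≤-trans (s≤s (m≤n+m x d)) (≤-reflexive eq)) (descend d (suc x) (trans (+-suc d x) eq))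
  ... | no ¬t₀ = inj₂ (none-tight⇒ ascend)
    where
    ascend : ∀ x → x ≤ N → ¬ Tight x
    ascend zero    _   t = ¬t₀ t
    ascend (suc x) x<N t = <⇒≱ short-N (enter⇒long x<N (ascend x (<⇒≤ x<N)) t)

circulant-free : ∀ r k → 4 ≤ k → 9 * suc k < 4 * (19 + r) → 4 * (19 + r) < 9 * suc k + 5 →
  CycleFree (suc k) (circulant r)
circulant-free r k 4≤k lower upper (f , f-injective , induced) =
  [ <⇒≢ lower ∘ ≡-sym , too-sparse ]′ (Density.density χ below (19 + r) (suc k) below-0 below-N below-suc ok (window-periodic χ χ-periodic) upper)
  where
  open InducedCycle (19 + r) (m≤m+n 19 r) k 4≤k f f-injective induced
  ok : ∀ x → T (admissible (window χ x ∷ʳ χ (8 + x)))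
  ok x = Equivalence.from T-∧
    ( nand₄ (χ x) (χ (1 + x)) (χ (3 + x)) (χ (4 + x)) (no-square x)
    , implies-≡2 (χ (4 + x)) (degree x))
  too-sparse : 5 * suc k ≤ 2 * (19 + r) → ⊥
  -- With L = k + 1, doubling gives 10 L ≤ 4 N < 9 L + 5, although L ≥ 5.
  too-sparse le = <⇒≱ upper (begin
    9 * suc k + 5              ≤⟨ +-monoʳ-≤ (9 * suc k) (s≤s 4≤k) ⟩
    9 * suc k + suc k          ≡⟨ solve 1 (λ l → con 9 :* l :+ l := con 2 :* (con 5 :* l)) refl (suc k) ⟩
    2 * (5 * suc k)            ≤⟨ *-monoʳ-≤ 2 le ⟩
    2 * (2 * (19 + r))         ≡⟨ ≡-sym (*-assoc 2 2 (19 + r)) ⟩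
    4 * (19 + r)               ∎)
    where
    open ≤-Reasoning
    open +-*-Solver

-- Deleting the only chord of a cycle.

linked⇒cycAdj : ∀ {k} (i j : Fin (suc k)) → Linked k (toℕ i) (toℕ j) → cycAdj k i j ≡ true
linked⇒cycAdj {k} i j l with toℕ j ≟ next k (toℕ i) | toℕ i ≟ next k (toℕ j)
... | yes _ | _     = refl
... | no _  | yes _ = refl
... | no p  | no q  = ⊥-elim ([ p , q ]′ l)

¬linked⇒cycAdj : ∀ {k} (i j : Fin (suc k)) → ¬ Linked k (toℕ i) (toℕ j) → cycAdj k i j ≡ false
¬linked⇒cycAdj {k} i j ¬l with toℕ j ≟ next k (toℕ i) | toℕ i ≟ next k (toℕ j)
... | yes p | _     = ⊥-elim (¬l (inj₁ p))
... | no _  | yes q = ⊥-elim (¬l (inj₂ q))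
... | no _  | no _  = refl

cycAdj⇒linked : ∀ {k} (i j : Fin (suc k)) → cycAdj k i j ≡ true → Linked k (toℕ i) (toℕ j)
cycAdj⇒linked {k} i j eq with toℕ j ≟ next k (toℕ i) | toℕ i ≟ next k (toℕ j)
... | yes p | _     = inj₁ p
... | no _  | yes q = inj₂ q
... | no _  | no _ with () ← eq

linked-< : ∀ {k i j} → i < j → j ≤ k → Linked k i j → j ≡ suc i ⊎ (i ≡ 0 × j ≡ k)
linked-< i<j j≤k (inj₁ p) = inj₁ (trans p (next-inner (<-≤-trans i<j j≤k)))
linked-< i<j j≤k (inj₂ p) with next-cases j≤k
... | inj₁ (_ , q) = ⊥-elim (<⇒≱ i<j (≤-trans (n≤1+n _) (≤-reflexive (≡-sym (trans p q)))))
... | inj₂ (q , z) = inj₂ (trans p z , q)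

sameEdge-self : ∀ {m} (a b : Fin m) → sameEdge a b a b ≡ true
sameEdge-self a b with a Data.Fin.≟ a | b Data.Fin.≟ b
... | yes _ | yes _ = refl
... | no ¬p | _     = ⊥-elim (¬p refl)
... | yes _ | no ¬p = ⊥-elim (¬p refl)

sameEdge-other : ∀ {m} {a b u v : Fin m} → ¬ (u ≡ a × v ≡ b) → ¬ (u ≡ b × v ≡ a) → sameEdge a b u v ≡ false
sameEdge-other {a = a} {b} {u} {v} ¬p ¬q
  with u Data.Fin.≟ a | v Data.Fin.≟ b | u Data.Fin.≟ b | v Data.Fin.≟ a
... | yes p | yes q | _     | _     = ⊥-elim (¬p (p , q))
... | _     | _     | yes p | yes q = ⊥-elim (¬q (p , q))
... | yes _ | no _  | yes _ | no _  = refl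
... | yes _ | no _  | no _  | _     = refl
... | no _  | _     | yes _ | no _  = refl
... | no _  | _     | no _  | _     = refl

-- Symmetry reduces the claim to increasing pairs. The deletion settles the exceptional pair, and
-- injectivity of f leaves every other pair untouched.
cycle-minus-chord : ∀ G {k} (f : Fin (suc k) → Fin (n G)) → Injective _≡_ _≡_ f →
  ∀ i₀ j₀ → toℕ i₀ < toℕ j₀ → cycAdj k i₀ j₀ ≡ false →
  (∀ i j → toℕ i < toℕ j → (i ≡ i₀ × j ≡ j₀) ⊎ adj G (f i) (f j) ≡ cycAdj k i j) →
  ∀ {a b} (e : adj G a b ≡ true) → f i₀ ≡ a → f j₀ ≡ b →
  HasInducedCycle (suc k) (deleteEdge G (a , b , e))
cycle-minus-chord G {k} f f-inj i₀ j₀ i₀<j₀ not-cyc pairs e refl refl = f , f-inj , agree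
  where
  G′ : Graph
  G′ = deleteEdge G (f i₀ , f j₀ , e)
  ordered : ∀ i j → toℕ i < toℕ j → adj G′ (f i) (f j) ≡ cycAdj k i j
  ordered i j i<j with i Data.Fin.≟ i₀ | j Data.Fin.≟ j₀ | pairs i j i<j
  ... | yes refl | yes refl | _ rewrite sameEdge-self (f i) (f j) = trans (∧-zeroʳ _) (≡-sym not-cyc)
  ... | no ¬p    | _        | inj₁ (p , _) = ⊥-elim (¬p p)
  ... | yes _    | no ¬q    | inj₁ (_ , q) = ⊥-elim (¬q q)
  ... | no ¬p    | _        | inj₂ eq
    rewrite sameEdge-other {a = f i₀} {f j₀} {f i} {f j} (λ h → ¬p (f-inj (proj₁ h)))
      (λ h → <-asym i<j (subst₂ (λ x y → toℕ x < toℕ y) (≡-sym (f-inj (proj₂ h))) (≡-sym (f-inj (proj₁ h))) i₀<j₀))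
    = trans (∧-identityʳ _) eq
  ... | yes _    | no ¬q    | inj₂ eq
    rewrite sameEdge-other {a = f i₀} {f j₀} {f i} {f j} (λ h → ¬q (f-inj (proj₂ h)))
      (λ h → <-asym i<j (subst₂ (λ x y → toℕ x < toℕ y) (≡-sym (f-inj (proj₂ h))) (≡-sym (f-inj (proj₁ h))) i₀<j₀))
    = trans (∧-identityʳ _) eq
  agree : ∀ i j → adj G′ (f i) (f j) ≡ cycAdj k i j
  agree i j with <-cmp (toℕ i) (toℕ j)
  ... | tri< i<j _ _ = ordered i j i<j
  ... | tri> _ _ j<i = trans (Graph.sym G′ (f i) (f j)) (trans (ordered j i j<i) (∨-comm ⌊ toℕ i ≟ next k (toℕ j) ⌋ ⌊ toℕ j ≟ next k (toℕ i) ⌋))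
  ... | tri≈ _ eq _ with refl ← toℕ-injective eq =
    trans (irr G′ (f i)) (≡-sym (¬linked⇒cycAdj i i (λ l → absurd ([ (λ x → x) , (λ x → x) ]′ l))))
    where
    absurd : toℕ i ≢ next k (toℕ i)
    absurd p with next-cases (s≤s⁻¹ (toℕ<n i))
    ... | inj₁ (_ , q) = 1+n≢n (≡-sym (trans p q))
    ... | inj₂ (q , z) = n≮0 (<-≤-trans i₀<j₀ (≤-trans (s≤s⁻¹ (toℕ<n j₀)) (≤-reflexive (trans (≡-sym q) (trans p z)))))

-- The two orientations of an edge are different elements of `Edge` but delete the same pairs.
deleteEdge-swap : ∀ G {k a b} (e : adj G a b ≡ true) (e′ : adj G b a ≡ true) →
  HasInducedCycle (suc k) (deleteEdge G (a , b , e)) → HasInducedCycle (suc k) (deleteEdge G (b , a , e′))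
deleteEdge-swap G {a = a} {b} e e′ (f , f-inj , agree) = f , f-inj , λ i j →
  trans (cong (λ x → adj G (f i) (f j) ∧ not x) (∨-comm (⌊ f i Data.Fin.≟ b ⌋ ∧ ⌊ f j Data.Fin.≟ a ⌋) _)) (agree i j)

-- Closed walks around the circulant.

-- A closed walk is a cyclic word of steps, each letter being the step plus 3, so that letters
-- are natural numbers; after i steps the walk has moved by travel − 3 i.  A state is the suffix
-- of the word that is still to be read.

advance : List ℕ → List ℕ → List ℕ
advance w (_ ∷ y ∷ ys) = y ∷ ys
advance w _            = w

letter : List ℕ → ℕ
letter []      = 0
letter (x ∷ _) = x

travel : List ℕ → List ℕ → ℕ → ℕ
travel w σ zero    = 0
travel w σ (suc i) = letter σ + travel w (advance w σ) i

state : List ℕ → List ℕ → ℕ → List ℕ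
state w σ zero    = σ
state w σ (suc i) = state w (advance w σ) i

travel-+ : ∀ w σ i e → travel w σ (i + e) ≡ travel w σ i + travel w (state w σ i) e
travel-+ w σ zero    e = refl
travel-+ w σ (suc i) e = trans (cong (letter σ +_) (travel-+ w (advance w σ) i e)) (≡-sym (+-assoc (letter σ) _ _))

state-length : ∀ w x xs → state w (x ∷ xs) (length (x ∷ xs)) ≡ w
state-length w x []       = refl
state-length w x (y ∷ ys) = state-length w y ys

travel-length : ∀ w x xs → travel w (x ∷ xs) (length (x ∷ xs)) ≡ sumˡ (x ∷ xs)
travel-length w x []       = refl
travel-length w x (y ∷ ys) = cong (x +_) (travel-length w y ys)

split : ∀ a {b} → T (a ∧ b) → T a × T b
split true h = tt , h

-- The nonempty suffixes of the word are the states of one period, so checking them all checks the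
-- whole closed walk.
suffixes : (List ℕ → Bool) → List ℕ → Bool
suffixes P []       = true
suffixes P (x ∷ xs) = P (x ∷ xs) ∧ suffixes P xs

suffixes-state : ∀ w P σ → T (suffixes P σ) → ∀ i → i < length σ → T (P (state w σ i))
suffixes-state w P (x ∷ xs)     h zero    _         = proj₁ (split (P (x ∷ xs)) h)
suffixes-state w P (x ∷ y ∷ ys) h (suc i) (s≤s lt) =
  suffixes-state w P (y ∷ ys) (proj₂ (split (P (x ∷ y ∷ ys)) h)) i lt

cyclic-state : ∀ y ys P → T (suffixes P (y ∷ ys)) → ∀ x xs → T (suffixes P (x ∷ xs)) →
  ∀ i → T (P (state (y ∷ ys) (x ∷ xs) i))
cyclic-state y ys P g x xs       h zero    = proj₁ (split (P (x ∷ xs)) h)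
cyclic-state y ys P g x []       h (suc i) = cyclic-state y ys P g y ys g i
cyclic-state y ys P g x (z ∷ zs) h (suc i) =
  cyclic-state y ys P g z zs (proj₂ (split (P (x ∷ z ∷ zs)) h)) i

-- Absolute displacement over e steps; each letter exceeds its step by 3.
shift : List ℕ → List ℕ → ℕ → ℕ
shift w σ e = ∣ travel w σ e - 3 * e ∣

-- Distinct and non-adjacent. The bound 12 keeps the distance the other way around at 5 or more when
-- N ≥ 19.
apart : ℕ → Bool
apart d = not (short d) ∧ (not (d ≡ᵇ 0) ∧ (d ≤ᵇ 12))

-- 17, 20, 23, 26 say that the walk moves forward by at least 5 in 4, 5, 6, 7 steps.
onward : List ℕ → List ℕ → Bool
onward w σ = short (shift w σ 1) ∧
  ((17 ≤ᵇ travel w σ 4) ∧ ((20 ≤ᵇ travel w σ 5) ∧ ((23 ≤ᵇ travel w σ 6) ∧ (26 ≤ᵇ travel w σ 7))))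

chordless : List ℕ → List ℕ → Bool
chordless w σ = apart (shift w σ 2) ∧ apart (shift w σ 3)

-- The first c steps move by d, which makes the chord; `5 ∸ c` is the other one of the lengths 2 and
-- 3. The bounds 3, 6, 9 keep the first three displacements nonnegative.
one-chord : ℕ → ℕ → List ℕ → Bool
one-chord c d w = (3 ≤ᵇ travel w w 1) ∧ ((6 ≤ᵇ travel w w 2) ∧ ((9 ≤ᵇ travel w w 3) ∧
  ((travel w w c ≡ᵇ d + 3 * c) ∧ apart (shift w w (5 ∸ c)))))

-- There are two lists because the starting state, where the chord begins, is exempt from
-- `chordless`.
regular : List ℕ → List ℕ → List ℕ → Bool
regular w σ τ = suffixes (onward w) σ ∧ suffixes (chordless w) τ

record ChordedCycle (N k d : ℕ) : Set where
  field
    first     : ℕ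
    rest      : List ℕ
    chord     : ℕ
  word : List ℕ
  word = first ∷ rest
  field
    chord-2∨3 : chord ≡ 2 ⊎ chord ≡ 3
    length≡   : length word ≡ suc k
    -- The steps add up to N, once around; the other term accounts for the 3 added to each letter.
    sum≡      : sumˡ word ≡ N + 3 * suc k
    checked   : T (one-chord chord d word ∧ regular word word rest)

  private
    start×regular : T (one-chord chord d word) × T (regular word word rest)
    start×regular = split (one-chord chord d word) checked

  start : T (one-chord chord d word)
  start = proj₁ start×regular

  steps : T (suffixes (onward word) word)
  steps = proj₁ (split (suffixes (onward word) word) (proj₂ start×regular))

  others : T (suffixes (chordless word) rest)
  others = proj₂ (split (suffixes (onward word) word) (proj₂ start×regular))

apart⇒ : ∀ d → T (apart d) → short d ≡ false × d ≢ 0 × d ≤ 12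
apart⇒ (suc d) h with short (suc d)
... | false = refl , (λ ()) , ≤ᵇ⇒≤ (suc d) 12 h

short⇒ : ∀ d → T (short d) → d ≢ 0 × d ≤ 12
short⇒ 2 _ = (λ ()) , m≤m+n 2 10
short⇒ 3 _ = (λ ()) , m≤m+n 3 9
short⇒ 4 _ = (λ ()) , m≤m+n 4 8

onward⇒ : ∀ w σ → T (onward w σ) → T (short (shift w σ 1)) × (∀ e → e < 4 → 17 + 3 * e ≤ travel w σ (4 + e))
onward⇒ w σ h
  with s , h ← split (short (shift w σ 1)) h
  with h₄ , h ← split (17 ≤ᵇ travel w σ 4) h
  with h₅ , h ← split (20 ≤ᵇ travel w σ 5) h
  with h₆ , h₇ ← split (23 ≤ᵇ travel w σ 6) h = s , far
  where
  far : ∀ e → e < 4 → 17 + 3 * e ≤ travel w σ (4 + e)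
  far 0 _ = ≤ᵇ⇒≤ 17 _ h₄
  far 1 _ = ≤ᵇ⇒≤ 20 _ h₅
  far 2 _ = ≤ᵇ⇒≤ 23 _ h₆
  far 3 _ = ≤ᵇ⇒≤ 26 _ h₇
  far (suc (suc (suc (suc _)))) (s≤s (s≤s (s≤s (s≤s ()))))

one-chord⇒ : ∀ c d w → T (one-chord c d w) →
  3 ≤ travel w w 1 × 6 ≤ travel w w 2 × 9 ≤ travel w w 3 × travel w w c ≡ d + 3 * c × T (apart (shift w w (5 ∸ c)))
one-chord⇒ c d w h
  with h₁ , h ← split (3 ≤ᵇ travel w w 1) h
  with h₂ , h ← split (6 ≤ᵇ travel w w 2) h
  with h₃ , h ← split (9 ≤ᵇ travel w w 3) h
  with h₄ , h₅ ← split (travel w w c ≡ᵇ d + 3 * c) h =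
  ≤ᵇ⇒≤ 3 _ h₁ , ≤ᵇ⇒≤ 6 _ h₂ , ≤ᵇ⇒≤ 9 _ h₃ , ≡ᵇ⇒≡ _ _ h₄ , h₅

-- Embedding a chorded walk into the circulant graph.

module Embed (N : ℕ) .{{_ : NonZero N}} (19≤N : 19 ≤ N) (k d : ℕ) (7≤k : 7 ≤ k)
  (d-short : T (short d)) (C : ChordedCycle N k d) (a : ℕ) where
  open ChordedCycle C

  L : ℕ
  L = suc k

  onward-at : ∀ i → T (onward word (state word word i))
  onward-at = cyclic-state first rest (onward word) steps first rest steps

  chordless-at : ∀ i → 1 ≤ i → i ≤ k → T (chordless word (state word word i))
  chordless-at (suc i) _ i<k = subst (T ∘ chordless word) (≡-sym (skip rest refl i lt))
      (suffixes-state word (chordless word) rest others i lt)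
    where
    lt : i < length rest
    lt = subst (i <_) (≡-sym (suc-injective length≡)) i<k
    skip : ∀ xs → xs ≡ rest → ∀ i → i < length xs → state word word (suc i) ≡ state word xs i
    skip (x ∷ xs) eq i _ = cong (λ σ → state word σ i) (lemma eq)
      where
      lemma : ∀ {ys} → x ∷ xs ≡ ys → advance word (first ∷ ys) ≡ x ∷ xs
      lemma refl = refl

  -- After i steps from a: the sum of the letters read, the true displacement, and the vertex
  -- reached. By `Q-≥` the subtraction never truncates.
  Q p F : ℕ → ℕ
  Q = travel word word
  p i = Q i ∸ 3 * i
  F i = (a + p i) % N

  travel-≥ : ∀ i e → e < 4 → 17 + 3 * e ≤ travel word (state word word i) (4 + e)
  travel-≥ i = proj₂ (onward⇒ word (state word word i) (onward-at i))

  -- Four or more steps split into groups of four and a last group of four to seven, each covered by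
  -- one of the checks in `onward`.
  Q-far : ∀ e i → Q i + (17 + 3 * e) ≤ Q (i + (4 + e))
  Q-far (suc (suc (suc (suc e)))) i = begin
    Q i + (17 + 3 * (4 + e))                    ≤⟨ +-monoʳ-≤ (Q i) (≤-trans (m≤m+n _ 5) (≤-reflexive (solve 1 (λ e → con 17 :+ con 3 :* (con 4 :+ e) :+ con 5 := con 17 :+ (con 17 :+ con 3 :* e)) refl e))) ⟩
    Q i + (17 + (17 + 3 * e))                   ≡⟨ ≡-sym (+-assoc (Q i) 17 (17 + 3 * e)) ⟩
    Q i + 17 + (17 + 3 * e)                     ≤⟨ +-monoˡ-≤ (17 + 3 * e) (+-monoʳ-≤ (Q i) (travel-≥ i 0 (s≤s z≤n))) ⟩
    Q i + travel word (state word word i) 4 + (17 + 3 * e) ≡⟨ cong (_+ (17 + 3 * e)) (≡-sym (travel-+ word word i 4)) ⟩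
    Q (i + 4) + (17 + 3 * e)                    ≤⟨ Q-far e (i + 4) ⟩
    Q (i + 4 + (4 + e))                         ≡⟨ cong Q (+-assoc i 4 (4 + e)) ⟩
    Q (i + (4 + (4 + e)))                       ∎
    where
    open ≤-Reasoning
    open +-*-Solver
  Q-far 0 i = ≤-trans (+-monoʳ-≤ (Q i) (travel-≥ i 0 (s≤s z≤n))) (≤-reflexive (≡-sym (travel-+ word word i 4)))
  Q-far 1 i = ≤-trans (+-monoʳ-≤ (Q i) (travel-≥ i 1 (s≤s (s≤s z≤n)))) (≤-reflexive (≡-sym (travel-+ word word i 5)))
  Q-far 2 i = ≤-trans (+-monoʳ-≤ (Q i) (travel-≥ i 2 (s≤s (s≤s (s≤s z≤n))))) (≤-reflexive (≡-sym (travel-+ word word i 6)))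
  Q-far 3 i = ≤-trans (+-monoʳ-≤ (Q i) (travel-≥ i 3 (s≤s (s≤s (s≤s (s≤s z≤n)))))) (≤-reflexive (≡-sym (travel-+ word word i 7)))

  start-facts : 3 ≤ Q 1 × 6 ≤ Q 2 × 9 ≤ Q 3 × Q chord ≡ d + 3 * chord × T (apart (shift word word (5 ∸ chord)))
  start-facts = one-chord⇒ chord d word start

  Q-≥ : ∀ i → 3 * i ≤ Q i
  Q-≥ 0 = z≤n
  Q-≥ 1 = proj₁ start-facts
  Q-≥ 2 = proj₁ (proj₂ start-facts)
  Q-≥ 3 = proj₁ (proj₂ (proj₂ start-facts))
  Q-≥ (suc (suc (suc (suc i)))) = ≤-trans
    (≤-trans (m≤m+n _ 5) (≤-reflexive (solve 1 (λ i → con 3 :* (con 4 :+ i) :+ con 5 := con 17 :+ con 3 :* i) refl i)))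
    (Q-far i 0)
    where open +-*-Solver

  p-Q : ∀ i → p i + 3 * i ≡ Q i
  p-Q i = m∸n+n≡m (Q-≥ i)

  p-travel : ∀ i e → p (i + e) + 3 * e ≡ p i + travel word (state word word i) e
  p-travel i e = +-cancelʳ-≡ (3 * i) _ _ (begin
    p (i + e) + 3 * e + 3 * i   ≡⟨ solve 3 (λ q i e → q :+ con 3 :* e :+ con 3 :* i := q :+ con 3 :* (i :+ e)) refl (p (i + e)) i e ⟩
    p (i + e) + 3 * (i + e)     ≡⟨ p-Q (i + e) ⟩
    Q (i + e)                   ≡⟨ travel-+ word word i e ⟩
    Q i + t                     ≡⟨ cong (_+ t) (≡-sym (p-Q i)) ⟩
    p i + 3 * i + t             ≡⟨ solve 3 (λ q i t → q :+ con 3 :* i :+ t := q :+ t :+ con 3 :* i) refl (p i) i t ⟩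
    p i + t + 3 * i             ∎)
    where
    open ≡-Reasoning
    open +-*-Solver
    t : ℕ
    t = travel word (state word word i) e

  p-shift : ∀ i e → ∣ p i - p (i + e) ∣ ≡ shift word (state word word i) e
  p-shift i e = begin
    ∣ p i - p (i + e) ∣                       ≡⟨ ≡-sym (∣m+n-m+o∣≡∣n-o∣ (3 * e) (p i) (p (i + e))) ⟩
    ∣ 3 * e + p i - 3 * e + p (i + e) ∣       ≡⟨ cong₂ ∣_-_∣ (+-comm (3 * e) (p i)) (trans (+-comm (3 * e) _) (p-travel i e)) ⟩
    ∣ p i + 3 * e - p i + t ∣                 ≡⟨ ∣m+n-m+o∣≡∣n-o∣ (p i) (3 * e) t ⟩
    ∣ 3 * e - t ∣                             ≡⟨ ∣-∣-comm (3 * e) t ⟩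
    ∣ t - 3 * e ∣                             ∎
    where
    open ≡-Reasoning
    t : ℕ
    t = travel word (state word word i) e

  p-far : ∀ i e → p i + 5 ≤ p (i + (4 + e))
  p-far i e = +-cancelʳ-≤ (3 * (i + (4 + e))) _ _ (begin
    p i + 5 + 3 * (i + (4 + e))     ≡⟨ solve 3 (λ q i e → q :+ con 5 :+ con 3 :* (i :+ (con 4 :+ e)) := q :+ con 3 :* i :+ (con 17 :+ con 3 :* e)) refl (p i) i e ⟩
    p i + 3 * i + (17 + 3 * e)      ≡⟨ cong (_+ (17 + 3 * e)) (p-Q i) ⟩
    Q i + (17 + 3 * e)              ≤⟨ Q-far e i ⟩
    Q (i + (4 + e))                 ≡⟨ ≡-sym (p-Q (i + (4 + e))) ⟩
    p (i + (4 + e)) + 3 * (i + (4 + e)) ∎)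
    where
    open ≤-Reasoning
    open +-*-Solver

  p-period : ∀ i → p (L + i) ≡ N + p i
  p-period i = +-cancelʳ-≡ (3 * (L + i)) _ _ (begin
    p (L + i) + 3 * (L + i)       ≡⟨ p-Q (L + i) ⟩
    Q (L + i)                     ≡⟨ travel-+ word word L i ⟩
    Q L + travel word (state word word L) i
      ≡⟨ cong₂ (λ x σ → x + travel word σ i)
           (trans (cong Q (≡-sym length≡)) (trans (travel-length word first rest) sum≡))
           (trans (cong (state word word) (≡-sym length≡)) (state-length word first rest)) ⟩
    N + 3 * L + Q i               ≡⟨ cong (N + 3 * L +_) (≡-sym (p-Q i)) ⟩
    N + 3 * L + (p i + 3 * i)     ≡⟨ solve 4 (λ n l q i → n :+ con 3 :* l :+ (q :+ con 3 :* i) := n :+ q :+ con 3 :* (l :+ i)) refl N L (p i) i ⟩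
    N + p i + 3 * (L + i)         ∎)
    where
    open ≡-Reasoning
    open +-*-Solver

  F-period : ∀ i → F (L + i) ≡ F i
  F-period i = begin
    (a + p (L + i)) % N   ≡⟨ cong (λ q → (a + q) % N) (p-period i) ⟩
    (a + (N + p i)) % N   ≡⟨ cong (_% N) (trans (cong (a +_) (+-comm N (p i))) (≡-sym (+-assoc a (p i) N))) ⟩
    (a + p i + N) % N     ≡⟨ [m+n]%n≡m%n (a + p i) N ⟩
    F i                   ∎
    where open ≡-Reasoning

  near-F : ∀ i j → ∣ p i - p j ∣ < N → near N ∣ F i - F j ∣ ≡ near N ∣ p i - p j ∣
  near-F i j lt = trans (near-% N (a + p i) (a + p j) (subst (_< N) (≡-sym (∣m+n-m+o∣≡∣n-o∣ a (p i) (p j))) lt))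
                        (cong (near N) (∣m+n-m+o∣≡∣n-o∣ a (p i) (p j)))

  F-≢ : ∀ i j → ∣ p i - p j ∣ < N → ∣ p i - p j ∣ ≢ 0 → F i ≢ F j
  F-≢ i j lt ≢0 eq = ≢0 (m≡n⇒∣m-n∣≡0 (+-cancelˡ-≡ a (p i) (p j)
    (%-injective-near N (a + p i) (a + p j) (subst (_< N) (≡-sym (∣m+n-m+o∣≡∣n-o∣ a (p i) (p j))) lt) eq)))

  Apart Joined : ℕ → ℕ → Set
  Apart  i j = near N ∣ F i - F j ∣ ≡ false × F i ≢ F j
  Joined i j = near N ∣ F i - F j ∣ ≡ true × F i ≢ F j

  ≤12⇒<N : ∀ {x} → x ≤ 12 → x < N
  ≤12⇒<N le = ≤-trans (s≤s le) (≤-trans (m≤m+n 13 6) 19≤N)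

  short⇒joined : ∀ i j → T (short ∣ p i - p j ∣) → Joined i j
  short⇒joined i j h with ≢0 , ≤12 ← short⇒ ∣ p i - p j ∣ h =
    trans (near-F i j (≤12⇒<N ≤12)) (cong (_∨ short (N ∸ ∣ p i - p j ∣)) (Equivalence.to T-≡ h)) ,
    F-≢ i j (≤12⇒<N ≤12) ≢0

  apart⇒apart : ∀ i j → T (apart ∣ p i - p j ∣) → Apart i j
  apart⇒apart i j h with sh , ≢0 , ≤12 ← apart⇒ ∣ p i - p j ∣ h =
    trans (near-F i j (≤12⇒<N ≤12))
      (cong₂ _∨_ sh (short-far (m+n≤o⇒m≤o∸n 5 (≤-trans (+-monoʳ-≤ 5 ≤12) (≤-trans (m≤m+n 17 2) 19≤N))))) ,
    F-≢ i j (≤12⇒<N ≤12) ≢0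

  step-joined : ∀ i → Joined i (i + 1)
  step-joined i = short⇒joined i (i + 1) (subst (T ∘ short) (≡-sym (p-shift i 1))
    (proj₁ (onward⇒ word (state word word i) (onward-at i))))

  apart-shift : ∀ i e → T (apart (shift word (state word word i) e)) → Apart i (i + e)
  apart-shift i e h = apart⇒apart i (i + e) (subst (T ∘ apart) (≡-sym (p-shift i e)) h)

  apart-2 : ∀ i → 1 ≤ i → i ≤ k → Apart i (i + 2)
  apart-2 i 1≤i i≤k = apart-shift i 2 (proj₁ (split (apart (shift word (state word word i) 2)) (chordless-at i 1≤i i≤k)))

  apart-3 : ∀ i → 1 ≤ i → i ≤ k → Apart i (i + 3)
  apart-3 i 1≤i i≤k = apart-shift i 3 (proj₂ (split (apart (shift word (state word word i) 2)) (chordless-at i 1≤i i≤k)))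

  -- At least four steps separate the indices in either direction, so the positions are at least 5
  -- apart both ways around. The way from j back to i is read as the way from j to i one period
  -- later.
  apart-far : ∀ i j → 4 + i ≤ j → 4 + j ≤ L + i → Apart i j
  apart-far i j le₁ le₂ = trans (near-F i j lt) (cong₂ _∨_ (short-far 5≤) (short-far 5≤′)) , F-≢ i j lt ≢0
    where
    up : p i + 5 ≤ p j
    up = subst (λ x → p i + 5 ≤ p x) (trans (≡-sym (+-assoc i 4 _)) (trans (cong (_+ (j ∸ (4 + i))) (+-comm i 4)) (m+[n∸m]≡n le₁))) (p-far i (j ∸ (4 + i)))
    down : p j + 5 ≤ N + p i
    down = subst (p j + 5 ≤_) (p-period i)
      (subst (λ x → p j + 5 ≤ p x) (trans (≡-sym (+-assoc j 4 _)) (trans (cong (_+ (L + i ∸ (4 + j))) (+-comm j 4)) (m+[n∸m]≡n le₂))) (p-far j (L + i ∸ (4 + j))))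
    D : ∣ p i - p j ∣ ≡ p j ∸ p i
    D = m≤n⇒∣m-n∣≡n∸m (≤-trans (m≤m+n (p i) 5) up)
    5≤ : 5 ≤ ∣ p i - p j ∣
    5≤ rewrite D = m+n≤o⇒m≤o∸n 5 (subst (_≤ p j) (+-comm (p i) 5) up)
    room : 5 + ∣ p i - p j ∣ ≤ N
    room rewrite D = +-cancelʳ-≤ (p i) _ _ (begin
      5 + (p j ∸ p i) + p i     ≡⟨ +-assoc 5 (p j ∸ p i) (p i) ⟩
      5 + (p j ∸ p i + p i)     ≡⟨ cong (5 +_) (m∸n+n≡m (≤-trans (m≤m+n (p i) 5) up)) ⟩
      5 + p j                   ≡⟨ +-comm 5 (p j) ⟩
      p j + 5                   ≤⟨ down ⟩
      N + p i                   ∎)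
      where open ≤-Reasoning
    lt : ∣ p i - p j ∣ < N
    lt = ≤-trans (+-monoˡ-≤ ∣ p i - p j ∣ (m≤m+n 1 4)) room
    5≤′ : 5 ≤ N ∸ ∣ p i - p j ∣
    5≤′ = m+n≤o⇒m≤o∸n 5 room
    ≢0 : ∣ p i - p j ∣ ≢ 0
    ≢0 eq = n≮0 (subst (5 ≤_) eq 5≤)

  f : Fin L → Fin N
  f i = fromℕ< (m%n<n (a + p (toℕ i)) N)

  toℕ-f : ∀ i → toℕ (f i) ≡ F (toℕ i)
  toℕ-f i = toℕ-fromℕ< (m%n<n (a + p (toℕ i)) N)

  chord<4 : 2 ≤ chord × chord ≤ 3
  chord<4 with chord | chord-2∨3
  ... | _ | inj₁ refl = ≤-refl , n≤1+n 2
  ... | _ | inj₂ refl = n≤1+n 2 , ≤-refl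

  Agree : ℕ → ℕ → Set
  Agree i j = (Linked k i j → near N ∣ F i - F j ∣ ≡ true) × (¬ Linked k i j → near N ∣ F i - F j ∣ ≡ false) × F i ≢ F j

  joined : ∀ {i j} → Linked k i j → Joined i j → Agree i j
  joined l (n , ≢) = (λ _ → n) , (λ ¬l → ⊥-elim (¬l l)) , ≢

  unjoined : ∀ {i j} → ¬ Linked k i j → Apart i j → Agree i j
  unjoined ¬l (n , ≢) = (λ l → ⊥-elim (¬l l)) , (λ _ → n) , ≢

  near-sym : ∀ {b} i j → near N ∣ F i - F j ∣ ≡ b × F i ≢ F j → near N ∣ F j - F i ∣ ≡ b × F j ≢ F i
  near-sym i j (eq , ≢) = trans (cong (near N) (∣-∣-comm (F j) (F i))) eq , ≢ ∘ ≡-sym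

  around : ∀ i j e → j + e ≡ L + i → F (j + e) ≡ F i
  around i j e eq = trans (cong F eq) (F-period i)

  ¬linked : ∀ {i j} → i < j → j ≤ k → j ≢ suc i → ¬ (i ≡ 0 × j ≡ k) → ¬ Linked k i j
  ¬linked i<j j≤k ¬p ¬q l = [ ¬p , ¬q ]′ (linked-< i<j j≤k l)

  chord-joined : Joined 0 chord
  chord-joined = short⇒joined 0 chord (subst (T ∘ short) (≡-sym eq) d-short)
    where
    eq : ∣ p 0 - p chord ∣ ≡ d
    eq = trans (cong (_∸ 3 * chord) (proj₁ (proj₂ (proj₂ (proj₂ start-facts))))) (m+n∸n≡m d (3 * chord))

  first-apart : ∀ j → j ≡ 5 ∸ chord → Apart 0 j
  first-apart _ refl = apart-shift 0 (5 ∸ chord) (proj₂ (proj₂ (proj₂ (proj₂ start-facts))))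

  -- At i = 0 the pair is the chord when `chord` is 2; otherwise `one-chord` has checked it.
  pair-2 : ∀ i → i + 2 ≤ k → (i ≡ 0 × i + 2 ≡ chord) ⊎ Apart i (i + 2)
  pair-2 (suc i) le = inj₂ (apart-2 (suc i) (s≤s z≤n) (≤-trans (m≤m+n (suc i) 2) le))
  pair-2 zero    _  with chord-2∨3
  ... | inj₁ c≡2 = inj₁ (refl , ≡-sym c≡2)
  ... | inj₂ c≡3 = inj₂ (first-apart 2 (cong (5 ∸_) (≡-sym c≡3)))

  pair-3 : ∀ i → i + 3 ≤ k → (i ≡ 0 × i + 3 ≡ chord) ⊎ Apart i (i + 3)
  pair-3 (suc i) le = inj₂ (apart-3 (suc i) (s≤s z≤n) (≤-trans (m≤m+n (suc i) 3) le))
  pair-3 zero    _  with chord-2∨3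
  ... | inj₁ c≡2 = inj₂ (first-apart 3 (cong (5 ∸_) (≡-sym c≡2)))
  ... | inj₂ c≡3 = inj₁ (refl , ≡-sym c≡3)

  not-next : ∀ {i j} → 4 + i ≤ j → j ≢ suc i
  not-next {i} le refl = m+n≮n 2 (suc i) le

  -- From j the walk meets i across the end of the word after e + 1 steps. One step is the closing
  -- edge; two or three steps start at a state other than the first, where `chordless` applies.
  wrapped : ∀ i j e → 4 + i ≤ j → j ≤ k → j + suc e ≡ L + i → e < 3 → Agree i j
  wrapped i j 0 i≪j j≤k eq _ = joined (inj₂ (trans i≡0 (≡-sym (trans (cong (next k) j≡k) (next-last k)))))
    (near-sym j i (subst (λ x → near N ∣ F j - x ∣ ≡ true × F j ≢ x) (around i j 1 eq) (step-joined j)))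
    where
    j≡k+i : j ≡ k + i
    j≡k+i = suc-injective (trans (+-comm 1 j) eq)
    i≡0 : i ≡ 0
    i≡0 = n≤0⇒n≡0 (+-cancelˡ-≤ k i 0 (≤-trans (≤-reflexive (≡-sym j≡k+i)) (≤-trans j≤k (≤-reflexive (≡-sym (+-identityʳ k))))))
    j≡k : j ≡ k
    j≡k = trans j≡k+i (trans (cong (k +_) i≡0) (+-identityʳ k))
  wrapped i j (suc e) i≪j j≤k eq e<3 =
    unjoined (¬linked (≤-trans (m≤n+m (suc i) 3) i≪j) j≤k (not-next i≪j) not-last)
      (near-sym j i (subst (λ x → near N ∣ F j - x ∣ ≡ false × F j ≢ x) (around i j (suc (suc e)) eq) (close e e<3)))
    where
    1≤j : 1 ≤ j
    1≤j = ≤-trans (s≤s z≤n) i≪j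
    close : ∀ e → suc e < 3 → Apart j (j + suc (suc e))
    close 0 _ = apart-2 j 1≤j j≤k
    close 1 _ = apart-3 j 1≤j j≤k
    close (suc (suc _)) (s≤s (s≤s (s≤s ())))
    not-last : ¬ (i ≡ 0 × j ≡ k)
    not-last (refl , refl) with () ← +-cancelˡ-≡ j (suc (suc e)) 1 (trans eq (trans (+-identityʳ (suc j)) (+-comm 1 j)))

  distant : ∀ i j → 4 + i ≤ j → j ≤ k → Agree i j
  distant i j i≪j j≤k with 4 + j ≤? L + i
  ... | yes le = unjoined (¬linked (≤-trans (m≤n+m (suc i) 3) i≪j) j≤k (not-next i≪j) not-last) (apart-far i j i≪j le)
    where
    not-last : ¬ (i ≡ 0 × j ≡ k)
    not-last (refl , refl) = m+n≮n 2 (suc j) (≤-trans le (≤-reflexive (+-identityʳ (suc j))))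
  ... | no ≰ with e , eq ← m≤n⇒∃[o]m+o≡n (≤-trans (s≤s j≤k) (m≤m+n L i)) =
    wrapped i j e i≪j j≤k (trans (+-suc j e) eq)
      (+-cancelˡ-≤ j (suc e) 3 (≤-trans (≤-reflexive (trans (+-suc j e) eq)) (≤-trans (s≤s⁻¹ (≰⇒> ≰)) (≤-reflexive (+-comm 3 j)))))

  pair-at : ∀ i e → i + suc e ≤ k → (i ≡ 0 × i + suc e ≡ chord) ⊎ Agree i (i + suc e)
  pair-at i 0 le = inj₂ (joined (inj₁ (trans (+-comm i 1) (≡-sym (next-inner (subst (_≤ k) (+-comm i 1) le))))) (step-joined i))
  pair-at i 1 le = map₂ (unjoined (¬linked (m<m+n i (s≤s z≤n)) le not-suc not-last)) (pair-2 i le)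
    where
    not-suc : i + 2 ≢ suc i
    not-suc eq with () ← +-cancelˡ-≡ i 2 1 (trans eq (+-comm 1 i))
    not-last : ¬ (i ≡ 0 × i + 2 ≡ k)
    not-last (refl , eq) = m+n≮n 4 2 (subst (7 ≤_) (≡-sym eq) 7≤k)
  pair-at i 2 le = map₂ (unjoined (¬linked (m<m+n i (s≤s z≤n)) le not-suc not-last)) (pair-3 i le)
    where
    not-suc : i + 3 ≢ suc i
    not-suc eq with () ← +-cancelˡ-≡ i 3 1 (trans eq (+-comm 1 i))
    not-last : ¬ (i ≡ 0 × i + 3 ≡ k)
    not-last (refl , eq) = m+n≮n 3 3 (subst (7 ≤_) (≡-sym eq) 7≤k)
  pair-at i (suc (suc (suc e))) le =
    inj₂ (distant i _ (≤-trans (≤-reflexive (+-comm 4 i)) (+-monoʳ-≤ i (m≤m+n 4 e))) le)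

  pair : ∀ i j → i < j → j ≤ k → (i ≡ 0 × j ≡ chord) ⊎ Agree i j
  pair i j i<j j≤k with e , eq ← m≤n⇒∃[o]m+o≡n i<j with refl ← trans (+-suc i e) eq = pair-at i e j≤k

  F-distinct : ∀ i j → i < j → j ≤ k → F i ≢ F j
  F-distinct i j i<j j≤k with pair i j i<j j≤k
  ... | inj₁ (refl , refl) = proj₂ chord-joined
  ... | inj₂ (_ , _ , ≢)   = ≢

  toℕ≤k : (i : Fin L) → toℕ i ≤ k
  toℕ≤k i = s≤s⁻¹ (toℕ<n i)

  f-injective : Injective _≡_ _≡_ f
  f-injective {i} {j} eq with <-cmp (toℕ i) (toℕ j)
  ... | tri< lt _ _ = ⊥-elim (F-distinct _ _ lt (toℕ≤k j) (trans (≡-sym (toℕ-f i)) (trans (cong toℕ eq) (toℕ-f j))))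
  ... | tri≈ _ e  _ = toℕ-injective e
  ... | tri> _ _ gt = ⊥-elim (F-distinct _ _ gt (toℕ≤k i) (trans (≡-sym (toℕ-f j)) (trans (cong toℕ (≡-sym eq)) (toℕ-f i))))

  chord<L : chord < L
  chord<L = s≤s (≤-trans (proj₂ chord<4) (≤-trans (m≤m+n 3 4) 7≤k))

  i₀ j₀ : Fin L
  i₀ = Data.Fin.zero
  j₀ = fromℕ< chord<L

  toℕ-j₀ : toℕ j₀ ≡ chord
  toℕ-j₀ = toℕ-fromℕ< chord<L

  f-pairs : ∀ i j → toℕ i < toℕ j →
    (i ≡ i₀ × j ≡ j₀) ⊎ near N ∣ toℕ (f i) - toℕ (f j) ∣ ≡ cycAdj k i j
  f-pairs i j lt with pair (toℕ i) (toℕ j) lt (toℕ≤k j)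
  ... | inj₁ (p , q) = inj₁ (toℕ-injective p , toℕ-injective (trans q (≡-sym toℕ-j₀)))
  ... | inj₂ (yes-linked , no-linked , _) rewrite toℕ-f i | toℕ-f j with cycAdj k i j in eq
  ...   | true  = inj₂ (yes-linked (cycAdj⇒linked i j eq))
  ...   | false = inj₂ (no-linked (λ l → false≢true (trans (≡-sym eq) (linked⇒cycAdj i j l))))
    where
    false≢true : false ≢ true
    false≢true ()

  f-i₀ : toℕ (f i₀) ≡ a % N
  f-i₀ = trans (toℕ-f i₀) (cong (_% N) (+-identityʳ a))

  f-j₀ : toℕ (f j₀) ≡ (a + d) % N
  f-j₀ = trans (toℕ-f j₀) (trans (cong F toℕ-j₀) (cong (λ x → (a + x) % N) p-chord))
    where
    p-chord : p chord ≡ d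
    p-chord = trans (cong (_∸ 3 * chord) (proj₁ (proj₂ (proj₂ (proj₂ start-facts))))) (m+n∸n≡m d (3 * chord))

  i₀<j₀ : toℕ i₀ < toℕ j₀
  i₀<j₀ = subst (0 <_) (≡-sym toℕ-j₀) (≤-trans (s≤s z≤n) (proj₁ chord<4))

  chord-unlinked : cycAdj k i₀ j₀ ≡ false
  chord-unlinked = ¬linked⇒cycAdj i₀ j₀ (¬linked i₀<j₀ (toℕ≤k j₀)
    (λ eq → <⇒≢ (proj₁ chord<4) (≡-sym (trans (≡-sym toℕ-j₀) eq)))
    (λ (_ , eq) → <⇒≢ (≤-<-trans (proj₂ chord<4) (≤-trans (m≤m+n 4 3) 7≤k)) (trans (≡-sym toℕ-j₀) eq)))

-- If the short way between u and v passes 0, their roles are exchanged; every edge thus becomes a,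
-- a + d with d one of 2, 3, 4.
edge-offset : ∀ {N} .{{_ : NonZero N}} (u v : Fin N) → toℕ u ≤ toℕ v → near N ∣ toℕ u - toℕ v ∣ ≡ true →
  (∃ λ d → T (short d) × toℕ v ≡ (toℕ u + d) % N) ⊎ (∃ λ d → T (short d) × toℕ u ≡ (toℕ v + d) % N)
edge-offset {N} u v u≤v nr with short ∣ toℕ u - toℕ v ∣ in eq
... | true = inj₁ (∣ toℕ u - toℕ v ∣ , Equivalence.from T-≡ eq ,
      ≡-sym (trans (cong (_% N) (trans (cong (toℕ u +_) (m≤n⇒∣m-n∣≡n∸m u≤v)) (m+[n∸m]≡n u≤v))) (m<n⇒m%n≡m (toℕ<n v))))
... | false = inj₂ (N ∸ ∣ toℕ u - toℕ v ∣ , Equivalence.from T-≡ nr , ≡-sym (begin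
      (toℕ v + (N ∸ D)) % N     ≡⟨ cong (λ x → (x + (N ∸ D)) % N) (≡-sym (trans (cong (toℕ u +_) (m≤n⇒∣m-n∣≡n∸m u≤v)) (m+[n∸m]≡n u≤v))) ⟩
      (toℕ u + D + (N ∸ D)) % N ≡⟨ cong (_% N) (trans (+-assoc (toℕ u) D _) (cong (toℕ u +_) (m+[n∸m]≡n D≤N))) ⟩
      (toℕ u + N) % N           ≡⟨ [m+n]%n≡m%n (toℕ u) N ⟩
      toℕ u % N                 ≡⟨ m<n⇒m%n≡m (toℕ<n u) ⟩
      toℕ u                     ∎))
    where
    open ≡-Reasoning
    D : ℕ
    D = ∣ toℕ u - toℕ v ∣
    D≤N : D ≤ N
    D≤N = ≤-trans (≤-reflexive (m≤n⇒∣m-n∣≡n∸m u≤v)) (≤-trans (m∸n≤m (toℕ v) (toℕ u)) (<⇒≤ (toℕ<n v)))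

delete-forward : ∀ r k → 7 ≤ k → (∀ d → T (short d) → ChordedCycle (19 + r) k d) →
  ∀ {u v} (e : adj (circulant r) u v ≡ true) d → T (short d) → toℕ v ≡ (toℕ u + d) % (19 + r) →
  HasInducedCycle (suc k) (deleteEdge (circulant r) (u , v , e))
delete-forward r k 7≤k C {u} {v} e d sh eq = cycle-minus-chord (circulant r) f f-injective i₀ j₀ i₀<j₀ chord-unlinked f-pairs e
    (toℕ-injective (trans f-i₀ (m<n⇒m%n≡m (toℕ<n u)))) (toℕ-injective (trans f-j₀ (≡-sym eq)))
  where open Embed (19 + r) (m≤m+n 19 r) k d 7≤k sh (C d sh) (toℕ u)

delete-ordered : ∀ r k → 7 ≤ k → (∀ d → T (short d) → ChordedCycle (19 + r) k d) →
  ∀ {u v} (e : adj (circulant r) u v ≡ true) → toℕ u ≤ toℕ v →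
  HasInducedCycle (suc k) (deleteEdge (circulant r) (u , v , e))
delete-ordered r k 7≤k C {u} {v} e u≤v with edge-offset u v u≤v e
... | inj₁ (d , sh , eq) = delete-forward r k 7≤k C e d sh eq
... | inj₂ (d , sh , eq) = deleteEdge-swap (circulant r) e′ e (delete-forward r k 7≤k C e′ d sh eq)
  where
  e′ : adj (circulant r) v u ≡ true
  e′ = trans (Graph.sym (circulant r) v u) e

delete-edge : ∀ r k → 7 ≤ k → (∀ d → T (short d) → ChordedCycle (19 + r) k d) →
  (e : Edge (circulant r)) → HasInducedCycle (suc k) (deleteEdge (circulant r) e)
delete-edge r k 7≤k C (u , v , e) with ≤-total (toℕ u) (toℕ v)
... | inj₁ u≤v = delete-ordered r k 7≤k C e u≤v
... | inj₂ v≤u = deleteEdge-swap (circulant r) e′ e (delete-ordered r k 7≤k C e′ v≤u)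
  where
  e′ : adj (circulant r) v u ≡ true
  e′ = trans (Graph.sym (circulant r) v u) e

-- Explicit words for both parities and the edge differences 2, 3, 4.

-- The block of steps 4, 4, −3, 4.
zigzags : ℕ → List ℕ → List ℕ
zigzags zero    σ = σ
zigzags (suc m) σ = 7 ∷ 7 ∷ 0 ∷ 7 ∷ zigzags m σ

length-zigzags : ∀ m σ → length (zigzags m σ) ≡ m * 4 + length σ
length-zigzags zero    σ = refl
length-zigzags (suc m) σ = cong (4 +_) (length-zigzags m σ)

sum-zigzags : ∀ m σ → sumˡ (zigzags m σ) ≡ m * 21 + sumˡ σ
sum-zigzags zero    σ = refl
sum-zigzags (suc m) σ = trans (cong (λ x → 7 + (7 + (7 + x))) (sum-zigzags m σ)) refl

-- In x ∷ A ++ zigzags m D, the seven letters inspected from a place inside a block reach at most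
-- two blocks further, so the check on a tail with three or more blocks repeats itself.

Accepted : ℕ → ℕ → ℕ → List ℕ → List ℕ → ℕ → Set
Accepted c d x A D m = T (one-chord c d (x ∷ A ++ zigzags m D) ∧
  regular (x ∷ A ++ zigzags m D) (x ∷ A ++ zigzags m D) (A ++ zigzags m D))

-- The word read on after the end begins with x, A and two explicit blocks, so every letter
-- inspected past the end is known.
RegularTail : ℕ → List ℕ → List ℕ → ℕ → ℕ → Set
RegularTail x A D m j = T (regular (x ∷ A ++ zigzags (2 + m) D) (zigzags j D) (zigzags j D))

chordedCycle : ∀ {N k d} c x A D m → c ≡ 2 ⊎ c ≡ 3 →
  suc (length A + (m * 4 + length D)) ≡ suc k →
  x + (sumˡ A + (m * 21 + sumˡ D)) ≡ N + 3 * suc k →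
  Accepted c d x A D m → ChordedCycle N k d
chordedCycle c x A D m c-2∨3 length-eq sum-eq accepted = record
  { first     = x
  ; rest      = A ++ zigzags m D
  ; chord     = c
  ; chord-2∨3 = c-2∨3
  ; length≡   = trans (cong suc (trans (length-++ A) (cong (length A +_) (length-zigzags m D)))) length-eq
  ; sum≡      = trans (cong (x +_) (trans (sum-++ A (zigzags m D)) (cong (sumˡ A +_) (sum-zigzags m D)))) sum-eq
  ; checked   = accepted
  }

even₂-tail : ∀ m j → RegularTail 7 (1 ∷ 6 ∷ []) (7 ∷ 5 ∷ 6 ∷ 5 ∷ 6 ∷ []) m j
even₂-tail m 0 = tt
even₂-tail m 1 = tt
even₂-tail m 2 = tt
even₂-tail m (suc (suc (suc j))) = even₂-tail m (suc (suc j))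

-- Steps 4, -2, 3, then m blocks, then 4, 2, 3, 2, 3; the chord spans 4 - 2 = 2.
even₂ : ∀ m → ChordedCycle (19 + m * 9) (7 + m * 4) 2
even₂ m = chordedCycle 2 7 (1 ∷ 6 ∷ []) (7 ∷ 5 ∷ 6 ∷ 5 ∷ 6 ∷ []) m (inj₁ refl)
  (solve 1 (λ m → con 3 :+ (m :* con 4 :+ con 5) := con 8 :+ m :* con 4) refl m)
  (solve 1 (λ m → con 7 :+ (con 7 :+ (m :* con 21 :+ con 29)) :=
    con 19 :+ m :* con 9 :+ con 3 :* (con 8 :+ m :* con 4)) refl m)
  (accepted m)
  where
  open +-*-Solver
  accepted : ∀ m → Accepted 2 2 7 (1 ∷ 6 ∷ []) (7 ∷ 5 ∷ 6 ∷ 5 ∷ 6 ∷ []) m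
  accepted 0             = tt
  accepted 1             = tt
  -- The checks at x and along A evaluate to true, leaving the tail with all 2 + m blocks.
  accepted (suc (suc m)) = even₂-tail m (2 + m)

even₃-tail : ∀ m j → RegularTail 5 (7 ∷ 0 ∷ 7 ∷ []) (7 ∷ 5 ∷ 6 ∷ 6 ∷ []) m j
even₃-tail m 0 = tt
even₃-tail m 1 = tt
even₃-tail m 2 = tt
even₃-tail m (suc (suc (suc j))) = even₃-tail m (suc (suc j))

-- The chord spans the first three steps 2, 4, -3, of total 3.
even₃ : ∀ m → ChordedCycle (19 + m * 9) (7 + m * 4) 3
even₃ m = chordedCycle 3 5 (7 ∷ 0 ∷ 7 ∷ []) (7 ∷ 5 ∷ 6 ∷ 6 ∷ []) m (inj₂ refl)
  (solve 1 (λ m → con 4 :+ (m :* con 4 :+ con 4) := con 8 :+ m :* con 4) refl m)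
  (solve 1 (λ m → con 5 :+ (con 14 :+ (m :* con 21 :+ con 24)) :=
    con 19 :+ m :* con 9 :+ con 3 :* (con 8 :+ m :* con 4)) refl m)
  (accepted m)
  where
  open +-*-Solver
  accepted : ∀ m → Accepted 3 3 5 (7 ∷ 0 ∷ 7 ∷ []) (7 ∷ 5 ∷ 6 ∷ 6 ∷ []) m
  accepted 0             = tt
  accepted 1             = tt
  accepted (suc (suc m)) = even₃-tail m (2 + m)

even₄-tail : ∀ m j → RegularTail 6 (7 ∷ 0 ∷ 7 ∷ []) (7 ∷ 5 ∷ 6 ∷ 5 ∷ []) m j
even₄-tail m 0 = tt
even₄-tail m 1 = tt
even₄-tail m 2 = tt
even₄-tail m (suc (suc (suc j))) = even₄-tail m (suc (suc j))

-- The chord spans the first three steps 3, 4, -3, of total 4.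
even₄ : ∀ m → ChordedCycle (19 + m * 9) (7 + m * 4) 4
even₄ m = chordedCycle 3 6 (7 ∷ 0 ∷ 7 ∷ []) (7 ∷ 5 ∷ 6 ∷ 5 ∷ []) m (inj₂ refl)
  (solve 1 (λ m → con 4 :+ (m :* con 4 :+ con 4) := con 8 :+ m :* con 4) refl m)
  (solve 1 (λ m → con 6 :+ (con 14 :+ (m :* con 21 :+ con 23)) :=
    con 19 :+ m :* con 9 :+ con 3 :* (con 8 :+ m :* con 4)) refl m)
  (accepted m)
  where
  open +-*-Solver
  accepted : ∀ m → Accepted 3 4 6 (7 ∷ 0 ∷ 7 ∷ []) (7 ∷ 5 ∷ 6 ∷ 5 ∷ []) m
  accepted 0             = tt
  accepted 1             = tt
  accepted (suc (suc m)) = even₄-tail m (2 + m)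

odd₂-tail : ∀ m j → RegularTail 7 (1 ∷ 6 ∷ []) (7 ∷ 5 ∷ 6 ∷ []) m j
odd₂-tail m 0 = tt
odd₂-tail m 1 = tt
odd₂-tail m 2 = tt
odd₂-tail m (suc (suc (suc j))) = odd₂-tail m (suc (suc j))

-- The word of `even₂` with one block more and without the final steps 2, 3: the length grows by 2
-- and the total by 9 - 5 = 4.
odd₂ : ∀ m → ChordedCycle (23 + m * 9) (9 + m * 4) 2
odd₂ m = chordedCycle 2 7 (1 ∷ 6 ∷ []) (7 ∷ 5 ∷ 6 ∷ []) (suc m) (inj₁ refl)
  (solve 1 (λ m → con 3 :+ ((con 1 :+ m) :* con 4 :+ con 3) := con 10 :+ m :* con 4) refl m)
  (solve 1 (λ m → con 7 :+ (con 7 :+ ((con 1 :+ m) :* con 21 :+ con 18)) :=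
    con 23 :+ m :* con 9 :+ con 3 :* (con 10 :+ m :* con 4)) refl m)
  (accepted m)
  where
  open +-*-Solver
  accepted : ∀ m → Accepted 2 2 7 (1 ∷ 6 ∷ []) (7 ∷ 5 ∷ 6 ∷ []) (suc m)
  accepted 0       = tt
  accepted (suc m) = odd₂-tail m (2 + m)

odd₃-tail : ∀ m j → RegularTail 5 (7 ∷ 0 ∷ 7 ∷ []) (7 ∷ 6 ∷ []) m j
odd₃-tail m 0 = tt
odd₃-tail m 1 = tt
odd₃-tail m 2 = tt
odd₃-tail m (suc (suc (suc j))) = odd₃-tail m (suc (suc j))

odd₃ : ∀ m → ChordedCycle (23 + m * 9) (9 + m * 4) 3
odd₃ m = chordedCycle 3 5 (7 ∷ 0 ∷ 7 ∷ []) (7 ∷ 6 ∷ []) (suc m) (inj₂ refl)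
  (solve 1 (λ m → con 4 :+ ((con 1 :+ m) :* con 4 :+ con 2) := con 10 :+ m :* con 4) refl m)
  (solve 1 (λ m → con 5 :+ (con 14 :+ ((con 1 :+ m) :* con 21 :+ con 13)) :=
    con 23 :+ m :* con 9 :+ con 3 :* (con 10 :+ m :* con 4)) refl m)
  (accepted m)
  where
  open +-*-Solver
  accepted : ∀ m → Accepted 3 3 5 (7 ∷ 0 ∷ 7 ∷ []) (7 ∷ 6 ∷ []) (suc m)
  accepted 0       = tt
  accepted (suc m) = odd₃-tail m (2 + m)

odd₄-tail : ∀ m j → RegularTail 6 (7 ∷ 0 ∷ 7 ∷ []) (7 ∷ 5 ∷ []) m j
odd₄-tail m 0 = tt
odd₄-tail m 1 = tt
odd₄-tail m 2 = tt
odd₄-tail m (suc (suc (suc j))) = odd₄-tail m (suc (suc j))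

odd₄ : ∀ m → ChordedCycle (23 + m * 9) (9 + m * 4) 4
odd₄ m = chordedCycle 3 6 (7 ∷ 0 ∷ 7 ∷ []) (7 ∷ 5 ∷ []) (suc m) (inj₂ refl)
  (solve 1 (λ m → con 4 :+ ((con 1 :+ m) :* con 4 :+ con 2) := con 10 :+ m :* con 4) refl m)
  (solve 1 (λ m → con 6 :+ (con 14 :+ ((con 1 :+ m) :* con 21 :+ con 12)) :=
    con 23 :+ m :* con 9 :+ con 3 :* (con 10 :+ m :* con 4)) refl m)
  (accepted m)
  where
  open +-*-Solver
  accepted : ∀ m → Accepted 3 4 6 (7 ∷ 0 ∷ 7 ∷ []) (7 ∷ 5 ∷ []) (suc m)
  accepted 0       = tt
  accepted (suc m) = odd₄-tail m (2 + m)

-- Critical graphs for every t.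

short-elim : (P : ℕ → Set) → P 2 → P 3 → P 4 → ∀ d → T (short d) → P d
short-elim P p₂ p₃ p₄ 2 _ = p₂
short-elim P p₂ p₃ p₄ 3 _ = p₃
short-elim P p₂ p₃ p₄ 4 _ = p₄

Critical : ℕ → Graph → Set
Critical L G = HasEdge G × CycleFree L G × ((e : Edge G) → HasInducedCycle L (deleteEdge G e))

-- The deficit 4N - 9L, with L = k + 1, is c + 1 and so lies strictly between 0 and 5, as
-- `circulant-free` requires.
circulant-critical : ∀ r k c → 7 ≤ k → c < 4 → 4 * (19 + r) ≡ 9 * suc k + suc c →
  (∀ d → T (short d) → ChordedCycle (19 + r) k d) → Critical (suc k) (circulant r)
circulant-critical r k c 7≤k c<4 eq C =
  (zero , suc (suc zero) , refl) ,
  circulant-free r k (≤-trans (m≤m+n 4 3) 7≤k)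
    (subst (9 * suc k <_) (≡-sym eq) (m<m+n (9 * suc k) (s≤s z≤n)))
    (subst (_< 9 * suc k + 5) (≡-sym eq) (+-monoʳ-< (9 * suc k) (s≤s c<4))) ,
  delete-edge r k 7≤k C

even-or-odd : ∀ s → ∃ λ m → s ≡ m + m ⊎ s ≡ suc (m + m)
even-or-odd zero = 0 , inj₁ refl
even-or-odd (suc s) with even-or-odd s
... | m , inj₁ refl = m , inj₂ refl
... | m , inj₂ refl = suc m , inj₁ (cong suc (≡-sym (+-suc m m)))

theorem1p6 : (t : ℕ) → 5 ≤ t →
    Σ Graph λ G →
    HasEdge G ×
    CycleFree (2 * t ∸ 2) G ×
    ((e : Edge G) → HasInducedCycle (2 * t ∸ 2) (deleteEdge G e))
theorem1p6 t 5≤t with m≤n⇒∃[o]m+o≡n 5≤t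
-- With t = 5 + s: for s = 2m the cycle length is 8 + 4m, N = 19 + 9m and the deficit is 4; for s =
-- 2m + 1 they are 10 + 4m, 23 + 9m and 2.
... | s , refl with even-or-odd s
...   | m , inj₁ refl = circulant (m * 9) , subst (λ L → Critical L (circulant (m * 9)))
          -- The right-hand side is what `2 * t ∸ 2` reduces to at t = 5 + (m + m).
          (solve 1 (λ m → con 8 :+ m :* con 4 := con 3 :+ (m :+ m) :+ (con 5 :+ ((m :+ m) :+ con 0))) refl m)
          (circulant-critical (m * 9) (7 + m * 4) 3 (m≤m+n 7 (m * 4)) (m≤m+n 4 0)
            (solve 1 (λ m → con 4 :* (con 19 :+ m :* con 9) := con 9 :* (con 8 :+ m :* con 4) :+ con 4) refl m)
            (short-elim (ChordedCycle _ _) (even₂ m) (even₃ m) (even₄ m)))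
  where open +-*-Solver
...   | m , inj₂ refl = circulant (4 + m * 9) , subst (λ L → Critical L (circulant (4 + m * 9)))
          (solve 1 (λ m → con 10 :+ m :* con 4 := con 3 :+ (con 1 :+ (m :+ m)) :+ (con 5 :+ ((con 1 :+ (m :+ m)) :+ con 0))) refl m)
          (circulant-critical (4 + m * 9) (9 + m * 4) 1 (m≤m+n 7 (2 + m * 4)) (m≤m+n 2 2)
            (solve 1 (λ m → con 4 :* (con 23 :+ m :* con 9) := con 9 :* (con 10 :+ m :* con 4) :+ con 2) refl m)
            (short-elim (ChordedCycle _ _) (odd₂ m) (odd₃ m) (odd₄ m)))
  where open +-*-Solver
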